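{- Let $a,b,c$ be non-negative integers, not all zero, and let $s=a+b+c$. Then: (1) the number of $\mathrm{D}$-triangulations of $\Delta(a,b,c)$ is $\binom{s-1}{a-1}+\binom{s-1}{b-1}+\binom{s-1}{c-1}$; (2) the number of $\mathrm{T}$-triangulations of $\Delta(a,b,c)$ is $2^{s-1}-\sum_{\ell=0}^{a-1}\binom{s-1}{\ell}-\sum_{\ell=0}^{b-1}\binom{s-1}{\ell}-\sum_{\ell=0}^{c-1}\binom{s-1}{\ell}$; (3) the total number of triangulations of $\Delta(a,b,c)$ is $2^{s-1}-\sum_{\ell=0}^{a-2}\binom{s-1}{\ell}-\sum_{\ell=0}^{b-2}\binom{s-1}{\ell}-\sum_{\ell=0}^{c-2}\binom{s-1}{\ell}$.
   Context: $\Delta(a,b,c)$ is a triangle $ABC$ whose side $BC$ is subdivided by $a$ points, side $CA$ by $b$ points and side $AB$ by $c$ points (all lying on the respective sides); it is a planar point set of $a+b+c+3$ points. A triangulation is a maximal dissection of the triangle into triangles by non-crossing segments between these points (no point lies in the interior of a side of a triangle). In a triangulation $T$: an ear is a triangle of $T$ containing a corner $A$, $B$ or $C$; a central triangle is a triangle of $T$ whose three vertices are interior points of three different sides of $ABC$; a corner-side diagonal is a segment of $T$ joining a corner to an interior point of the opposite side. A $\mathrm{T}$-triangulation is one having a central triangle (equivalently three ears and no corner-side diagonal); a $\mathrm{D}$-triangulation is one having no central triangle (equivalently two ears and at least one corner-side diagonal). Conventions: $\binom{n}{m}=0$ for $m<0$, and empty sums are $0$. -}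

module Defs where

open import Data.Nat using (ℕ; zero; suc; _+_; _*_; _∸_; _^_; _≤_; _<_)
open import Data.Nat.Combinatorics using (_C_)
open import Data.Fin using (Fin; toℕ)
open import Data.Bool using (Bool; true)
open import Data.Vec using (Vec; lookup)
open import Data.List using (List; length; map; upTo)
open import Data.Nat.ListAction using (sum)
open import Data.List.Membership.Propositional using (_∈_)
open import Data.List.Relation.Unary.Unique.Propositional using (Unique)
open import Data.Product using (Σ; _×_; ∃)
open import Data.Sum using (_⊎_)
open import Relation.Nullary using (¬_)
open import Relation.Binary.PropositionalEquality using (_≡_)
open import Function.Bundles using (_⇔_)

-- Combinatorial model of Δ(a,b,c).
-- The N = a+b+c+3 points are numbered 0..N-1 in cyclic order around
-- the boundary of ABC:
--   A = 0,  interior points of AB = 1..c,  B = c+1,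
--   interior points of BC = c+2..c+a+1,  C = c+a+2,
--   interior points of CA = c+a+3..c+a+b+2 = N-1.

module _ (a b c : ℕ) where

  N : ℕ
  N = a + b + c + 3

  OnAB OnBC OnCA : ℕ → Set
  OnAB i = i ≤ c + 1
  OnBC i = c + 1 ≤ i × i ≤ c + a + 2
  OnCA i = c + a + 2 ≤ i ⊎ i ≡ 0

  InAB InBC InCA : ℕ → Set
  InAB i = 1 ≤ i × i ≤ c
  InBC i = c + 2 ≤ i × i ≤ c + a + 1
  InCA i = c + a + 3 ≤ i

  SameSide : ℕ → ℕ → Set
  SameSide i j = (OnAB i × OnAB j) ⊎ (OnBC i × OnBC j) ⊎ (OnCA i × OnCA j)

  -- a segment between i and j may be a diagonal (it is not contained in a
  -- side of ABC; segments inside a side contain no interior of the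
  -- triangle, and only consecutive points on a side are edges of a
  -- triangulation -- those are the boundary edges below)
  Allowed : ℕ → ℕ → Set
  Allowed i j = ¬ SameSide i j

  -- for i < j and k < l: the segments ij and kl cross (in the interior)
  -- iff their endpoints strictly interleave in the cyclic order
  Cross : ℕ → ℕ → ℕ → ℕ → Set
  Cross i j k l = (i < k × k < j × j < l) ⊎ (k < i × i < l × l < j)

  -- a set of diagonals: an N×N Boolean matrix; entry (i,j) = true
  -- encodes the diagonal {i,j} (only entries with i < j are used)
  DiagSet : Set
  DiagSet = Vec (Vec Bool N) N

  Has : DiagSet → Fin N → Fin N → Set
  Has M i j = lookup (lookup M i) j ≡ true

  IsTriangulation : DiagSet → Set
  IsTriangulation M =
      (∀ i j → Has M i j → toℕ i < toℕ j × Allowed (toℕ i) (toℕ j))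
    × (∀ i j k l → Has M i j → Has M k l →
         ¬ Cross (toℕ i) (toℕ j) (toℕ k) (toℕ l))
    × (∀ i j → toℕ i < toℕ j → Allowed (toℕ i) (toℕ j) → ¬ Has M i j →
         Σ (Fin N) λ k → Σ (Fin N) λ l →
           Has M k l × Cross (toℕ i) (toℕ j) (toℕ k) (toℕ l))

  Boundary : ℕ → ℕ → Set
  Boundary i j = j ≡ suc i ⊎ i ≡ suc j ⊎ (i ≡ 0 × suc j ≡ N) ⊎ (j ≡ 0 × suc i ≡ N)

  Edge : DiagSet → Fin N → Fin N → Set
  Edge M i j = Has M i j ⊎ Has M j i ⊎ Boundary (toℕ i) (toℕ j)

  HasCentralTriangle : DiagSet → Set
  HasCentralTriangle M =
    Σ (Fin N) λ i → Σ (Fin N) λ j → Σ (Fin N) λ k →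
      InBC (toℕ i) × InCA (toℕ j) × InAB (toℕ k)
      × Edge M i j × Edge M j k × Edge M i k

  IsTTriangulation : DiagSet → Set
  IsTTriangulation M = IsTriangulation M × HasCentralTriangle M

  IsDTriangulation : DiagSet → Set
  IsDTriangulation M = IsTriangulation M × ¬ HasCentralTriangle M

NumberIs : {X : Set} → (X → Set) → ℕ → Set
NumberIs {X} P n = Σ (List X) λ L → Unique L × (∀ x → (x ∈ L) ⇔ P x) × length L ≡ n

-- binomial with convention (m choose k) = 0 for k < 0:
-- binom' m a = (m choose (a - 1)), which is 0 when a = 0
binomPred : ℕ → ℕ → ℕ
binomPred m zero = 0
binomPred m (suc k) = m C k

bsum : ℕ → ℕ → ℕ
bsum m k = sum (map (m C_) (upTo k))

{-# OPTIONS --safe #-}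

-- Order the points cyclically and read Δ(a,b,c) as a degenerate convex polygon.
-- Every side x < z of a triangulation that is not a boundary edge has a unique
-- apex between x and z, so triangulations correspond to binary trees rooted at
-- the side from the first to the last point.  Peeling apexes off that side, one
-- walks through the edges joining AB to CA.  The walk may move along AB or along
-- CA; it ends when it reaches B or C, leaving a strip between two sides, or when
-- the apex lies inside BC, leaving two strips.  A strip is triangulated along a
-- lattice path, and the third kind of step is the central triangle (or, when the
-- walk is still at A, a diagonal from A).  Chu–Vandermonde sums the
-- pairs of strips, and Pascal's rule solves the recursion of the walk.
module Submission where

open import Defs
open import Data.Bool using (Bool; true; false; T; if_then_else_)
import Data.Bool as Bool
open import Data.Empty using (⊥; ⊥-elim)
open import Data.Fin using (Fin; toℕ; fromℕ<)
open import Data.Fin.Properties using (toℕ-fromℕ<; toℕ<n; toℕ-injective; any?)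
open import Data.List using (List; []; _∷_; _++_; length; map; concatMap; cartesianProductWith; filter; upTo)
open import Data.List.Properties using (length-++; length-map; upTo-∷ʳ; map-++)
open import Data.List.Membership.Propositional using (_∈_)
open import Data.List.Membership.Propositional.Properties
  using ( ∈-cartesianProductWith⁺; ∈-cartesianProductWith⁻; ∈-concat⁺′; ∈-concat⁻′; ∈-map⁺; ∈-map⁻
        ; ∈-filter⁺; ∈-filter⁻; ∈-++⁺ˡ; ∈-++⁺ʳ; ∈-++⁻)
open import Data.List.Membership.Propositional.Properties.WithK using (unique∧set⇒bag)
open import Data.List.Relation.Binary.BagAndSetEquality using (∼bag⇒↭)
open import Data.List.Relation.Binary.Permutation.Propositional.Properties using (↭-length)
open import Data.List.Relation.Unary.All as All using (All; []; _∷_)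
import Data.List.Relation.Unary.All.Properties as All
open import Data.List.Relation.Unary.AllPairs as AllPairs using ([]; _∷_)
import Data.List.Relation.Unary.AllPairs.Properties as AllPairs
open import Data.List.Relation.Unary.Any using (here; there)
open import Data.List.Relation.Unary.Unique.Propositional using (Unique)
import Data.List.Relation.Unary.Unique.Propositional.Properties as Unique
open import Data.Nat
open import Data.Nat.ListAction using (sum)
open import Data.Nat.ListAction.Properties using (sum-++)
open import Data.Nat.Properties
open import Data.Nat.Tactic.RingSolver using (solve-∀)
open import Data.Product using (Σ; ∃₂; _×_; _,_; proj₁; proj₂)
open import Data.Sum using (_⊎_; inj₁; inj₂; swap)
open import Data.Unit using (tt)
open import Data.Vec using (Vec; lookup; tabulate)
open import Data.Vec.Properties using (lookup∘tabulate; tabulate∘lookup; tabulate-cong)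
open import Function using (_∘_)
open import Function.Bundles using (_⇔_; mk⇔; Equivalence)
open import Relation.Binary.Definitions using (tri<; tri≈; tri>)
open import Relation.Binary.PropositionalEquality
open import Relation.Nullary using (¬_; Dec; yes; no; does)
open import Relation.Nullary.Decidable using (_×-dec_; _⊎-dec_; ¬?; T?; dec-true; decidable-stable)

-- Having no central triangle is a condition on single triangles, so it can be imposed at every apex
-- while trees are enumerated; having one is not. Hence a switch `g` runs the same enumeration
-- twice, once for D-triangulations and once for all triangulations, and the number of
-- T-triangulations is obtained as a difference. The closed form for the latter is kept additive,
-- which avoids truncated subtraction.
--
-- Degeneracy of the polygon is the obstacle, in two ways. Diagonals along a side of ABC are
-- forbidden, so maximality of a set of diagonals does not at once put a triangle on every edge: its
-- third side might be forbidden. The choice of the last joined point as apex repairs this. Moreover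
-- the base lies on CA and its first point A also lies on AB, so the walk obeys other rules at its
-- start than later on; and without points inside CA the base ends at C, which needs a separate
-- case.

-- Binary trees and the edges of the triangulations they encode.

data Tree : Set where
  leaf : Tree
  node : ℕ → Tree → Tree → Tree

node-injective : ∀ {k l r k′ l′ r′} → node k l r ≡ node k′ l′ r′ → k ≡ k′ × l ≡ l′ × r ≡ r′
node-injective refl = refl , refl , refl

-- All sides of all triangles of the polygon i..j, including the boundary edges
-- p, p+1 and the base i, j itself.
data Edges : Tree → (i j p q : ℕ) → Set where
  base  : ∀ {t i j} → Edges t i j i j
  left  : ∀ {k l r i j p q} → Edges l i k p q → Edges (node k l r) i j p q
  right : ∀ {k l r i j p q} → Edges r k j p q → Edges (node k l r) i j p q

edges? : ∀ t i j p q → Dec (Edges t i j p q)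
edges? t i j p q with i ≟ p ×-dec j ≟ q
... | yes (refl , refl) = yes base
edges? leaf i j p q | no ¬base = no λ { base → ¬base (refl , refl) }
edges? (node k l r) i j p q | no ¬base with edges? l i k p q | edges? r k j p q
... | yes e | _     = yes (left e)
... | _     | yes e = yes (right e)
... | no ¬l | no ¬r = no λ { base → ¬base (refl , refl) ; (left e) → ¬l e ; (right e) → ¬r e }

Crossing : (i j k l : ℕ) → Set
Crossing i j k l = (i < k × k < j × j < l) ⊎ (k < i × i < l × l < j)

largestBelow : ∀ {P : ℕ → Set} → (∀ k → Dec (P k)) → ∀ {i} j → P i → i < j →
  Σ ℕ λ k → i ≤ k × k < j × P k × (∀ l → k < l → l < j → ¬ P l)
largestBelow {P} P? {i} (suc j) Pi i<1+j with P? j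
... | yes Pj = j , s≤s⁻¹ i<1+j , ≤-refl , Pj , λ l j<l l<1+j → ⊥-elim (<⇒≱ j<l (s≤s⁻¹ l<1+j))
... | no ¬Pj with m≤n⇒m<n∨m≡n (s≤s⁻¹ i<1+j)
...   | inj₂ refl = ⊥-elim (¬Pj Pi)
...   | inj₁ i<j with largestBelow P? j Pi i<j
...     | k , i≤k , k<j , Pk , above = k , i≤k , m<n⇒m<1+n k<j , Pk , above′
  where
  above′ : ∀ l → k < l → l < suc j → ¬ P l
  above′ l k<l l<1+j with m≤n⇒m<n∨m≡n (s≤s⁻¹ l<1+j)
  ... | inj₁ l<j  = above l k<l l<j
  ... | inj₂ refl = ¬Pj

range : ℕ → ℕ → List ℕ
range lo zero    = []
range lo (suc n) = lo ∷ range (suc lo) n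

-- Triangulations of a polygon with a prescribed set of admissible diagonals.

module Polygon
  (A : ℕ → ℕ → Set) (A? : ∀ i j → Dec (A i j))
  (Good : ℕ → ℕ → ℕ → Set) (good? : ∀ i k j → Dec (Good i k j))
  where

  -- A is the relation of admissible diagonals; the base of the polygon is never
  -- tested, so it may itself be inadmissible.
  Ok : ℕ → ℕ → Set
  Ok i j = j ≡ suc i ⊎ A i j

  Apex : ℕ → ℕ → ℕ → Set
  Apex i k j = Ok i k × Ok k j × Good i k j

  apex? : ∀ i k j → Dec (Apex i k j)
  apex? i k j = (k ≟ suc i ⊎-dec A? i k) ×-dec ((j ≟ suc k ⊎-dec A? k j) ×-dec good? i k j)

  data Triangulates : ℕ → ℕ → Tree → Set where
    leaf : ∀ {i} → Triangulates i (suc i) leaf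
    node : ∀ {i k j l r} → i < k → k < j → Apex i k j → Triangulates i k l → Triangulates k j r → Triangulates i j (node k l r)

  private variable
    i j k l p q x y z : ℕ
    t t′ u v : Tree

  triangulates-< : Triangulates i j t → i < j
  triangulates-< leaf = ≤-refl
  triangulates-< (node i<k k<j _ _ _) = <-trans i<k k<j

  edge-< : Triangulates i j t → Edges t i j p q → p < q
  edge-< w base = triangulates-< w
  edge-< (node _ _ _ wl wr) (left e)  = edge-< wl e
  edge-< (node _ _ _ wl wr) (right e) = edge-< wr e

  edge-≥ : Triangulates i j t → Edges t i j p q → i ≤ p
  edge-≥ w base = ≤-refl
  edge-≥ (node _ _ _ wl wr) (left e)  = edge-≥ wl e
  edge-≥ (node i<k _ _ wl wr) (right e) = ≤-trans (<⇒≤ i<k) (edge-≥ wr e)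

  edge-≤ : Triangulates i j t → Edges t i j p q → q ≤ j
  edge-≤ w base = ≤-refl
  edge-≤ (node _ k<j _ wl wr) (left e)  = ≤-trans (edge-≤ wl e) (<⇒≤ k<j)
  edge-≤ (node i<k _ _ wl wr) (right e) = edge-≤ wr e

  edge-ok : Triangulates i j t → Edges t i j p q → (p ≡ i × q ≡ j) ⊎ Ok p q
  edge-ok w base = inj₁ (refl , refl)
  edge-ok (node _ _ (okl , _) wl wr) (left e) with edge-ok wl e
  ... | inj₁ (refl , refl) = inj₂ okl
  ... | inj₂ ok = inj₂ ok
  edge-ok (node _ _ (_ , okr , _) wl wr) (right e) with edge-ok wr e
  ... | inj₁ (refl , refl) = inj₂ okr
  ... | inj₂ ok = inj₂ ok

  boundary-edge : Triangulates i j t → i ≤ p → p < j → Edges t i j p (suc p)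
  boundary-edge leaf i≤p p<1+i with ≤-antisym i≤p (s≤s⁻¹ p<1+i)
  ... | refl = base
  boundary-edge {p = p} (node {k = k} _ _ _ wl wr) i≤p p<j with p <? k
  ... | yes p<k = left (boundary-edge wl i≤p p<k)
  ... | no p≮k  = right (boundary-edge wr (≮⇒≥ p≮k) p<j)

  -- The base encloses every edge, and edges from different subtrees lie in the intervals i..k and
  -- k..j, which share only the apex, so their ends cannot strictly interleave.
  noncrossing : Triangulates i j t → Edges t i j p q → Edges t i j k l → ¬ Crossing p q k l
  noncrossing w base e′ (inj₁ (_ , _ , j<l)) = <⇒≱ j<l (edge-≤ w e′)
  noncrossing w base e′ (inj₂ (k<i , _))     = <⇒≱ k<i (edge-≥ w e′)
  noncrossing w e base (inj₁ (p<i , _))      = <⇒≱ p<i (edge-≥ w e)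
  noncrossing w e base (inj₂ (_ , _ , j<q))  = <⇒≱ j<q (edge-≤ w e)
  noncrossing (node _ _ _ wl wr) (left e)  (left e′)  c = noncrossing wl e e′ c
  noncrossing (node _ _ _ wl wr) (right e) (right e′) c = noncrossing wr e e′ c
  noncrossing (node _ _ _ wl wr) (left e)  (right e′) (inj₁ (_ , k<q , _)) =
    <⇒≱ k<q (≤-trans (edge-≤ wl e) (edge-≥ wr e′))
  noncrossing (node _ _ _ wl wr) (left e)  (right e′) (inj₂ (k<p , _)) =
    <⇒≱ (<-trans k<p (edge-< wl e)) (≤-trans (edge-≤ wl e) (edge-≥ wr e′))
  noncrossing (node _ _ _ wl wr) (right e) (left e′)  (inj₁ (p<k , _)) =
    <⇒≱ (<-trans p<k (edge-< wl e′)) (≤-trans (edge-≤ wl e′) (edge-≥ wr e))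
  noncrossing (node _ _ _ wl wr) (right e) (left e′)  (inj₂ (_ , p<l , _)) =
    <⇒≱ p<l (≤-trans (edge-≤ wl e′) (edge-≥ wr e))

  -- Nothing crosses a boundary edge; a side satisfying `Ok` that is crossed is therefore an
  -- admissible diagonal.
  crossing-nonadjacent : Crossing p q k l → l ≢ suc k
  crossing-nonadjacent (inj₁ (_ , k<q , q<l)) refl = <⇒≱ q<l k<q
  crossing-nonadjacent (inj₂ (k<p , p<l , _)) refl = <⇒≱ p<l k<p

  -- A pair on one side of the apex is handled by that subtree. A pair straddling the apex is the
  -- base, or it misses i and crosses the side i, k, or it starts at i and crosses the side k, j.
  maximal : Triangulates i j t → i ≤ p → p < q → q ≤ j →
    Edges t i j p q ⊎ ∃₂ λ k l → Edges t i j k l × A k l × Crossing p q k l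
  maximal leaf i≤p p<q q≤1+i with ≤-antisym i≤p (s≤s⁻¹ (≤-trans p<q q≤1+i))
  ... | refl with ≤-antisym p<q q≤1+i
  ...   | refl = inj₁ base
  maximal {i = i} {j = j} {t = t} {p = p} {q = q} (node {k = k} i<k k<j (okl , okr , _) wl wr) i≤p p<q q≤j
    with q ≤? k | k ≤? p
  ... | yes q≤k | _ with maximal wl i≤p p<q q≤k
  ...   | inj₁ e = inj₁ (left e)
  ...   | inj₂ (_ , _ , e , a , c) = inj₂ (_ , _ , left e , a , c)
  maximal (node i<k k<j (okl , okr , _) wl wr) i≤p p<q q≤j | no q≰k | yes k≤p with maximal wr k≤p p<q q≤j
  ...   | inj₁ e = inj₁ (right e)
  ...   | inj₂ (_ , _ , e , a , c) = inj₂ (_ , _ , right e , a , c)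
  maximal {i = i} {j = j} {t = t} {p = p} {q = q} (node {k = k} i<k k<j (okl , okr , _) wl wr) i≤p p<q q≤j
    | no q≰k | no k≰p with m≤n⇒m<n∨m≡n i≤p | m≤n⇒m<n∨m≡n q≤j
  ... | inj₂ refl | inj₂ refl = inj₁ base
  ... | inj₁ i<p  | _ = inj₂ (i , k , left base , ok⇒allowed okl , cross)
    where
    cross : Crossing p q i k
    cross = inj₂ (i<p , ≰⇒> k≰p , ≰⇒> q≰k)
    ok⇒allowed : Ok i k → A i k
    ok⇒allowed (inj₁ adj) = ⊥-elim (crossing-nonadjacent cross adj)
    ok⇒allowed (inj₂ a)   = a
  ... | inj₂ refl | inj₁ q<j = inj₂ (k , j , right base , ok⇒allowed okr , cross)
    where
    cross : Crossing p q k j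
    cross = inj₁ (≰⇒> k≰p , ≰⇒> q≰k , q<j)
    ok⇒allowed : Ok k j → A k j
    ok⇒allowed (inj₁ adj) = ⊥-elim (crossing-nonadjacent cross adj)
    ok⇒allowed (inj₂ a)   = a

  -- An edge from i other than the base ends at k or before, an edge into j other than the base
  -- begins at k or after; they can meet only at k.
  apex-unique : Triangulates i j (node k u v) →
    Edges (node k u v) i j i y → Edges (node k u v) i j y j → y ≡ k
  apex-unique w base e′ = ⊥-elim (<-irrefl refl (edge-< w e′))
  apex-unique w e base = ⊥-elim (<-irrefl refl (edge-< w e))
  apex-unique (node i<k _ _ wl wr) (right e) e′ = ⊥-elim (<⇒≱ i<k (edge-≥ wr e))
  apex-unique (node _ k<j _ wl wr) (left e) (left e′) = ⊥-elim (<⇒≱ k<j (edge-≤ wl e′))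
  apex-unique (node _ _ _ wl wr) (left e) (right e′) = ≤-antisym (edge-≤ wl e) (edge-≥ wr e′)

  edge-left : Triangulates i j (node k u v) → Edges (node k u v) i j p q → q ≤ k → Edges u i k p q
  edge-left (node _ k<j _ _ _) base q≤k = ⊥-elim (<⇒≱ k<j q≤k)
  edge-left _ (left e) _ = e
  edge-left (node _ _ _ _ wr) (right e) q≤k = ⊥-elim (<⇒≱ (edge-< wr e) (≤-trans q≤k (edge-≥ wr e)))

  edge-right : Triangulates i j (node k u v) → Edges (node k u v) i j p q → k ≤ p → Edges v k j p q
  edge-right (node i<k _ _ _ _) base k≤p = ⊥-elim (<⇒≱ i<k k≤p)
  edge-right (node _ _ _ wl _) (left e) k≤p = ⊥-elim (<⇒≱ (edge-< wl e) (≤-trans (edge-≤ wl e) k≤p))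
  edge-right _ (right e) _ = e

  -- Any three mutually joined points bound a triangle of the tree.
  triangle-good : Triangulates i j t → Edges t i j x y → Edges t i j y z → Edges t i j x z → Good x y z
  triangle-good leaf base e₂ base = ⊥-elim (<-irrefl refl (edge-< leaf e₂))
  triangle-good w@(node _ _ (_ , _ , g) _ _) e₁ e₂ base with apex-unique w e₁ e₂
  ... | refl = g
  triangle-good w@(node _ _ _ wl wr) e₁ e₂ (left e₃) =
    triangle-good wl (edge-left w e₁ (≤-trans (<⇒≤ (edge-< w e₂)) (edge-≤ wl e₃)))
                     (edge-left w e₂ (edge-≤ wl e₃)) e₃
  triangle-good w@(node _ _ _ wl wr) e₁ e₂ (right e₃) =
    triangle-good wr (edge-right w e₁ (edge-≥ wr e₃))
                     (edge-right w e₂ (≤-trans (edge-≥ wr e₃) (<⇒≤ (edge-< w e₁)))) e₃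

  -- One inclusion suffices: the two sides of the root triangle of `t` are edges of `t′` as well,
  -- where they can meet only at the root apex of `t′`.
  edges-injective : Triangulates i j t → Triangulates i j t′ →
    (∀ {p q} → Edges t i j p q → Edges t′ i j p q) → t ≡ t′
  edges-injective leaf leaf _ = refl
  edges-injective leaf (node i<k k<j _ _ _) _ = ⊥-elim (<⇒≱ i<k (s≤s⁻¹ k<j))
  edges-injective (node i<k k<j _ _ _) leaf _ = ⊥-elim (<⇒≱ i<k (s≤s⁻¹ k<j))
  edges-injective w@(node _ _ _ wl wr) w′@(node _ _ _ wl′ wr′) sub
    with apex-unique w′ (sub (left base)) (sub (right base))
  ... | refl = cong₂ (node _)
    (edges-injective wl wl′ λ e → edge-left w′ (sub (left e)) (edge-≤ wl e))
    (edges-injective wr wr′ λ e → edge-right w′ (sub (right e)) (edge-≥ wr e))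

  -- A set of diagonals records admissible edges only. Nothing is lost, because the base and the
  -- boundary edges belong to every triangulation.
  allowed-edges-injective : Triangulates i j t → Triangulates i j t′ →
    (∀ {p q} → A p q → Edges t i j p q → Edges t′ i j p q) → t ≡ t′
  allowed-edges-injective {i} {j} {t} {t′} w w′ sub = edges-injective w w′ sub′
    where
    sub′ : ∀ {p q} → Edges t i j p q → Edges t′ i j p q
    sub′ e with edge-ok w e
    ... | inj₁ (refl , refl) = base
    ... | inj₂ (inj₁ refl)   = boundary-edge w′ (edge-≥ w e) (edge-≤ w e)
    ... | inj₂ (inj₂ a)      = sub a e

  -- Every maximal set of non-crossing diagonals comes from a tree.

  module Complete
    (L : ℕ)
    -- The maximality argument for an apex k of i, j fails if k, j lie on a common
    -- line; then every diagonal crossing i, k+1 would have to run along that line.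
    (degenerate : ∀ {i j k} → A i j ⊎ (i ≡ 0 × j ≡ L) → Ok i k → i < k → suc k < j → j ≤ L →
       ¬ A k j → A i (suc k) × (∀ q → k < q → q ≤ j → ¬ A k q))
    (H : ℕ → ℕ → Set) (H? : ∀ i j → Dec (H i j))
    (H-allowed : ∀ {i j} → H i j → i < j × j ≤ L × A i j)
    (H-noncrossing : ∀ {i j k l} → H i j → H k l → ¬ Crossing i j k l)
    (H-maximal : ∀ {i j} → i < j → j ≤ L → A i j → ¬ H i j → ∃₂ λ k l → H k l × Crossing i j k l)
    where

    Side : ℕ → ℕ → Set
    Side i j = j ≡ suc i ⊎ (i ≡ 0 × j ≡ L) ⊎ H i j

    side? : ∀ i j → Dec (Side i j)
    side? i j = j ≟ suc i ⊎-dec ((i ≟ 0 ×-dec j ≟ L) ⊎-dec H? i j)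

    side-noncrossing : Side i j → H p q → ¬ Crossing i j p q
    side-noncrossing (inj₁ refl) h (inj₁ (i<p , p<1+i , _)) = <⇒≱ i<p (s≤s⁻¹ p<1+i)
    side-noncrossing (inj₁ refl) h (inj₂ (_ , i<q , q<1+i)) = <⇒≱ i<q (s≤s⁻¹ q<1+i)
    side-noncrossing (inj₂ (inj₁ (_ , refl))) h (inj₁ (_ , _ , L<q)) = <⇒≱ L<q (proj₁ (proj₂ (H-allowed h)))
    side-noncrossing (inj₂ (inj₁ (refl , _))) h (inj₂ (() , _))
    side-noncrossing (inj₂ (inj₂ h′)) h c = H-noncrossing h′ h c

    side-ok : Side i j → 0 < i ⊎ j < L → Ok i j
    side-ok (inj₁ adj) _ = inj₁ adj
    side-ok (inj₂ (inj₁ (refl , refl))) (inj₂ L<L) = ⊥-elim (<-irrefl refl L<L)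
    side-ok (inj₂ (inj₂ h)) _ = inj₂ (proj₂ (proj₂ (H-allowed h)))

    -- The apex is the last point k before j joined to i.
    apex : Side i j → suc i < j → j ≤ L → Σ ℕ λ k → i < k × k < j × Side i k × Side k j
    apex {i} {j} s 1+i<j j≤L with largestBelow (side? i) j (inj₁ refl) 1+i<j
    ... | k , i<k , k<j , sik , above = k , i<k , k<j , sik , skj
      where
      beyond : ∀ {q} → k < q → q < j → ¬ H i q
      beyond k<q q<j h = above _ k<q q<j (inj₂ (inj₂ h))

      skj : Side k j
      skj with m≤n⇒m<n∨m≡n k<j
      ... | inj₂ 1+k≡j = inj₁ (sym 1+k≡j)
      ... | inj₁ 1+k<j with A? k j
      skj | inj₁ 1+k<j | yes a with H? k j
      skj | inj₁ 1+k<j | yes a | yes h = inj₂ (inj₂ h)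
      skj | inj₁ 1+k<j | yes a | no ¬h with H-maximal k<j j≤L a ¬h
      ... | p , q , h , inj₁ (k<p , p<j , j<q) =
        ⊥-elim (side-noncrossing s h (inj₁ (<-trans i<k k<p , p<j , j<q)))
      ... | p , q , h , inj₂ (p<k , k<q , q<j) with <-cmp p i
      ...   | tri< p<i _ _ = ⊥-elim (side-noncrossing s h (inj₂ (p<i , <-trans i<k k<q , q<j)))
      ...   | tri≈ _ refl _ = ⊥-elim (beyond k<q q<j h)
      ...   | tri> _ _ i<p = ⊥-elim (side-noncrossing sik h (inj₁ (i<p , p<k , k<q)))
      skj | inj₁ 1+k<j | no ¬a = ⊥-elim (contra (H? i (suc k)))
        where
        aij : Side i j → A i j ⊎ (i ≡ 0 × j ≡ L)
        aij (inj₁ refl)      = ⊥-elim (<-irrefl refl 1+i<j)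
        aij (inj₂ (inj₁ eq)) = inj₂ eq
        aij (inj₂ (inj₂ h))  = inj₁ (proj₂ (proj₂ (H-allowed h)))
        deg : A i (suc k) × (∀ q → k < q → q ≤ j → ¬ A k q)
        deg = degenerate (aij s) (side-ok sik (inj₂ (<-≤-trans k<j j≤L))) i<k 1+k<j j≤L ¬a
        contra : Dec (H i (suc k)) → ⊥
        contra (yes h) = beyond ≤-refl 1+k<j h
        contra (no ¬h) with H-maximal (m<n⇒m<1+n i<k) (≤-trans (<⇒≤ 1+k<j) j≤L) (proj₁ deg) ¬h
        ... | p , q , h , inj₂ (p<i , i<q , q<1+k) =
          side-noncrossing s h (inj₂ (p<i , i<q , ≤-<-trans (s≤s⁻¹ q<1+k) k<j))
        ... | p , q , h , inj₁ (i<p , p<1+k , 1+k<q) with m≤n⇒m<n∨m≡n (s≤s⁻¹ p<1+k)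
        ...   | inj₁ p<k = side-noncrossing sik h (inj₁ (i<p , p<k , <⇒≤ 1+k<q))
        ...   | inj₂ refl with q ≤? j
        ...     | yes q≤j = proj₂ deg q (<⇒≤ 1+k<q) q≤j (proj₂ (proj₂ (H-allowed h)))
        ...     | no q≰j  = side-noncrossing s h (inj₁ (i<p , k<j , ≰⇒> q≰j))

    -- The apex lies strictly between i and j, so neither new side can be the untested base 0, `L`;
    -- this is what `side-ok` requires. The fuel bounds j - i, and both parts are shorter.
    build : (∀ {x y z} → x < y → y < z → z ≤ L → Side x y → Side y z → Side x z → Good x y z) →
      ∀ n {i j} → j ≤ n + i → i < j → j ≤ L → Side i j →
      Σ Tree λ t → Triangulates i j t × (∀ {p q} → Edges t i j p q → Side p q)
    build good zero j≤i i<j _ _ = ⊥-elim (<⇒≱ i<j j≤i)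
    build good (suc n) {i} {j} j≤n+i i<j j≤L s with m≤n⇒m<n∨m≡n i<j
    ... | inj₂ refl = leaf , leaf , λ { base → s }
    ... | inj₁ 1+i<j with apex s 1+i<j j≤L
    ...   | k , i<k , k<j , sik , skj
      with build good n (s≤s⁻¹ (≤-trans k<j j≤n+i)) i<k (≤-trans (<⇒≤ k<j) j≤L) sik
         | build good n (≤-trans j≤n+i (≤-trans (≤-reflexive (sym (+-suc n i))) (+-monoʳ-≤ n i<k))) k<j j≤L skj
    ...     | l , wl , el | r , wr , er =
      node k l r
      , node i<k k<j (side-ok sik (inj₂ (<-≤-trans k<j j≤L)) , side-ok skj (inj₁ (≤-<-trans z≤n i<k))
                     , good i<k k<j j≤L sik skj s) wl wr
      , λ { base → s ; (left e) → el e ; (right e) → er e }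

    -- Each inclusion uses one maximality: that of the tree makes every diagonal of `H` an edge,
    -- that of `H` puts every admissible edge into `H`. Otherwise two sides would cross.
    complete : (∀ {x y z} → x < y → y < z → z ≤ L → Side x y → Side y z → Side x z → Good x y z) → 0 < L →
      Σ Tree λ t → Triangulates 0 L t ×
        (∀ {p q} → H p q → Edges t 0 L p q × A p q) × (∀ {p q} → Edges t 0 L p q → A p q → H p q)
    complete good 0<L with build good L (m≤m+n L 0) 0<L ≤-refl (inj₂ (inj₁ (refl , refl)))
    ... | t , w , side = t , w , to , from
      where
      to : ∀ {p q} → H p q → Edges t 0 L p q × A p q
      to {p} {q} h with H-allowed h
      ... | p<q , q≤L , a with maximal w z≤n p<q q≤L
      ...   | inj₁ e = e , a
      ...   | inj₂ (_ , _ , e , _ , cross) = ⊥-elim (side-noncrossing (side e) h (swap cross))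
      from : ∀ {p q} → Edges t 0 L p q → A p q → H p q
      from {p} {q} e a with H? p q
      ... | yes h = h
      ... | no ¬h with H-maximal (edge-< w e) (edge-≤ w e) a ¬h
      ...   | _ , _ , h , cross = ⊥-elim (side-noncrossing (side e) h cross)

-- Lattice path numbers.

-- Triangulations of two chains of p+1 and q+1 points, the first points joined
-- to a common tip, the last ones to each other.
paths : ℕ → ℕ → ℕ
paths zero    q       = 1
paths (suc p) zero    = 1
paths (suc p) (suc q) = paths p (suc q) + paths (suc p) q

paths-zeroʳ : ∀ p → paths p 0 ≡ 1
paths-zeroʳ zero    = refl
paths-zeroʳ (suc p) = refl

-- Contributions of an apex before, at and after the common corner of the two chains. The corner
-- serves only for the last triangle, whose other vertices are its two neighbours.
viaLeft atTip viaRight : ℕ → ℕ → ℕ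
viaLeft zero    q = 0
viaLeft (suc p) q = paths p q
atTip zero zero = 1
atTip _    _    = 0
viaRight p zero    = 0
viaRight p (suc q) = paths p q

paths-split : ∀ p q → viaLeft p q + (atTip p q + viaRight p q) ≡ paths p q
paths-split zero    zero    = refl
paths-split zero    (suc q) = refl
paths-split (suc p) zero    = trans (+-identityʳ _) (paths-zeroʳ p)
paths-split (suc p) (suc q) = refl


-- Ranges of candidate apexes and sums over them.

∈-range⁻ : ∀ {k} lo n → k ∈ range lo n → lo ≤ k × k < lo + n
∈-range⁻ lo (suc n) (here refl) = ≤-refl , m<m+n lo z<s
∈-range⁻ {k} lo (suc n) (there k∈) with ∈-range⁻ (suc lo) n k∈
... | lo<k , k< = <⇒≤ lo<k , subst (k <_) (sym (+-suc lo n)) k<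

∈-range⁺ : ∀ {k} lo n → lo ≤ k → k < lo + n → k ∈ range lo n
∈-range⁺ {k} lo zero lo≤k k< = ⊥-elim (<⇒≱ (subst (k <_) (+-identityʳ lo) k<) lo≤k)
∈-range⁺ {k} lo (suc n) lo≤k k< with m≤n⇒m<n∨m≡n lo≤k
... | inj₂ refl = here refl
... | inj₁ lo<k = there (∈-range⁺ (suc lo) n lo<k (subst (k <_) (+-suc lo n) k<))

range-unique : ∀ lo n → Unique (range lo n)
range-unique lo zero    = []
range-unique lo (suc n) = All.tabulate (λ k∈ → <⇒≢ (proj₁ (∈-range⁻ (suc lo) n k∈))) ∷ range-unique (suc lo) n

sumFrom : ℕ → ℕ → (ℕ → ℕ) → ℕ
sumFrom lo zero    f = 0
sumFrom lo (suc n) f = f lo + sumFrom (suc lo) n f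

length-concatMap-range : ∀ {B : Set} (f : ℕ → List B) lo n →
  length (concatMap f (range lo n)) ≡ sumFrom lo n (length ∘ f)
length-concatMap-range f lo zero    = refl
length-concatMap-range f lo (suc n) = trans (length-++ (f lo)) (cong (length (f lo) +_) (length-concatMap-range f (suc lo) n))

sumFrom-zero : ∀ lo n {f} → (∀ k → lo ≤ k → k < lo + n → f k ≡ 0) → sumFrom lo n f ≡ 0
sumFrom-zero lo zero    f≡0 = refl
sumFrom-zero lo (suc n) f≡0 = cong₂ _+_ (f≡0 lo ≤-refl (m<m+n lo z<s))
  (sumFrom-zero (suc lo) n λ k lo<k k< → f≡0 k (<⇒≤ lo<k) (subst (k <_) (sym (+-suc lo n)) k<))

sumFrom-first : ∀ lo n {f} → (∀ k → lo < k → k < lo + suc n → f k ≡ 0) → sumFrom lo (suc n) f ≡ f lo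
sumFrom-first lo n {f} f≡0 = trans (cong (f lo +_) (sumFrom-zero (suc lo) n
  λ k lo<k k< → f≡0 k lo<k (subst (k <_) (sym (+-suc lo n)) k<))) (+-identityʳ _)

sumFrom-++ : ∀ lo m n f → sumFrom lo (m + n) f ≡ sumFrom lo m f + sumFrom (lo + m) n f
sumFrom-++ lo zero n f = cong (λ x → sumFrom x n f) (sym (+-identityʳ lo))
sumFrom-++ lo (suc m) n f = begin
  f lo + sumFrom (suc lo) (m + n) f ≡⟨ cong (f lo +_) (sumFrom-++ (suc lo) m n f) ⟩
  f lo + (sumFrom (suc lo) m f + sumFrom (suc lo + m) n f) ≡⟨ sym (+-assoc (f lo) _ _) ⟩
  f lo + sumFrom (suc lo) m f + sumFrom (suc lo + m) n f
    ≡⟨ cong (λ x → f lo + sumFrom (suc lo) m f + sumFrom x n f) (sym (+-suc lo m)) ⟩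
  f lo + sumFrom (suc lo) m f + sumFrom (lo + suc m) n f ∎
  where open ≡-Reasoning

sumFrom-last : ∀ lo n {f} → (∀ k → lo ≤ k → k < lo + n → f k ≡ 0) → sumFrom lo (suc n) f ≡ f (lo + n)
sumFrom-last lo n {f} f≡0 = begin
  sumFrom lo (suc n) f                       ≡⟨ cong (λ x → sumFrom lo x f) (+-comm 1 n) ⟩
  sumFrom lo (n + 1) f                       ≡⟨ sumFrom-++ lo n 1 f ⟩
  sumFrom lo n f + (f (lo + n) + 0)          ≡⟨ cong₂ _+_ (sumFrom-zero lo n f≡0) (+-identityʳ _) ⟩
  f (lo + n)                                 ∎
  where open ≡-Reasoning

length-cartesianProductWith : ∀ {A B C : Set} (f : A → B → C) xs ys →
  length (cartesianProductWith f xs ys) ≡ length xs * length ys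
length-cartesianProductWith f []       ys = refl
length-cartesianProductWith f (x ∷ xs) ys =
  trans (length-++ (map (f x) ys)) (cong₂ _+_ (length-map (f x) ys) (length-cartesianProductWith f xs ys))

-- Listing and counting the trees of a polygon.

module Enumeration
  (A : ℕ → ℕ → Set) (A? : ∀ i j → Dec (A i j))
  (Good : ℕ → ℕ → ℕ → Set) (good? : ∀ i k j → Dec (Good i k j))
  where
  open Polygon A A? Good good?

  private variable
    i j k : ℕ
    t : Tree

  -- The number n is fuel: all trees are found once j ≤ n + i.
  trees  : (n i j : ℕ) → List Tree
  branch : (n i j k : ℕ) → List Tree
  trees zero    i j = []
  trees (suc n) i j with j ≟ suc i
  ... | yes _ = leaf ∷ []
  ... | no  _ = concatMap (branch n i j) (range (suc i) (j ∸ suc i))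
  branch n i j k with apex? i k j
  ... | yes _ = cartesianProductWith (node k) (trees n i k) (trees n k j)
  ... | no  _ = []

  fuel-left : ∀ {n} → j ≤ suc n + i → k < j → k ≤ n + i
  fuel-left j≤ k<j = s≤s⁻¹ (≤-trans k<j j≤)

  fuel-right : ∀ n → j ≤ suc n + i → i < k → j ≤ n + k
  fuel-right {i = i} n j≤ i<k = ≤-trans j≤ (≤-trans (≤-reflexive (sym (+-suc n i))) (+-monoʳ-≤ n i<k))

  branch-root : ∀ n i j k → t ∈ branch n i j k → ∃₂ λ l r → t ≡ node k l r
  branch-root n i j k t∈ with apex? i k j
  ... | yes _ with ∈-cartesianProductWith⁻ (node k) (trees n i k) (trees n k j) t∈
  ...   | l , r , _ , _ , eq = l , r , eq

  trees-sound : ∀ n i j → t ∈ trees n i j → Triangulates i j t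
  trees-sound (suc n) i j t∈ with j ≟ suc i
  trees-sound (suc n) i j (here refl) | yes refl = leaf
  trees-sound (suc n) i j t∈ | no _
    with ∈-concat⁻′ (map (branch n i j) (range (suc i) (j ∸ suc i))) t∈
  ... | _ , t∈ts , ts∈ with ∈-map⁻ (branch n i j) ts∈
  ...   | k , k∈ , refl with apex? i k j
  ...     | yes apex with ∈-cartesianProductWith⁻ (node k) (trees n i k) (trees n k j) t∈ts
  ...       | l , r , l∈ , r∈ , refl with ∈-range⁻ (suc i) (j ∸ suc i) k∈ | suc i ≤? j
  ...         | i<k , k< | yes i<j =
    node i<k (subst (k <_) (m+[n∸m]≡n i<j) k<) apex (trees-sound n i k l∈) (trees-sound n k j r∈)
  -- The truncated difference `j ∸ suc i` is 0 here, so there is no candidate apex.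
  ...         | i<k , k< | no i≮j =
    ⊥-elim (<⇒≱ (subst (k <_) (trans (cong (suc i +_) (m≤n⇒m∸n≡0 (<⇒≤ (≰⇒> i≮j)))) (+-identityʳ _)) k<) i<k)

  trees-complete : ∀ n → j ≤ n + i → Triangulates i j t → t ∈ trees n i j
  trees-complete zero j≤i w = ⊥-elim (<⇒≱ (triangulates-< w) j≤i)
  trees-complete {j} {i} (suc n) j≤ w with j ≟ suc i
  trees-complete (suc n) j≤ leaf | yes _ = here refl
  trees-complete (suc n) j≤ (node i<k k<j _ _ _) | yes refl = ⊥-elim (<⇒≱ i<k (s≤s⁻¹ k<j))
  trees-complete (suc n) j≤ leaf | no j≢ = ⊥-elim (j≢ refl)
  trees-complete {j} {i} (suc n) j≤ (node {k = k} i<k k<j apex wl wr) | no _ =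
    ∈-concat⁺′ t∈ (∈-map⁺ (branch n i j) (∈-range⁺ (suc i) (j ∸ suc i) i<k
      (subst (k <_) (sym (m+[n∸m]≡n (<-trans i<k k<j))) k<j)))
    where
    t∈ : node k _ _ ∈ branch n i j k
    t∈ with apex? i k j
    ... | yes _ = ∈-cartesianProductWith⁺ (node k) (trees-complete n (fuel-left {n = n} j≤ k<j) wl)
                                                   (trees-complete n (fuel-right n j≤ i<k) wr)
    ... | no ¬apex = ⊥-elim (¬apex apex)

  trees-unique  : ∀ n i j → Unique (trees n i j)
  branch-unique : ∀ n i j k → Unique (branch n i j k)
  trees-unique zero i j = []
  trees-unique (suc n) i j with j ≟ suc i
  ... | yes _ = [] ∷ []
  ... | no  _ = Unique.concat⁺
    (All.map⁺ (All.universal (branch-unique n i j) (range (suc i) (j ∸ suc i))))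
    (AllPairs.map⁺ (AllPairs.map disjoint (range-unique (suc i) (j ∸ suc i))))
    where
    disjoint : ∀ {k l} → k ≢ l → ∀ {t} → ¬ (t ∈ branch n i j k × t ∈ branch n i j l)
    disjoint {k} {l} k≢l (t∈k , t∈l) with branch-root n i j k t∈k | branch-root n i j l t∈l
    ... | _ , _ , refl | _ , _ , eq = k≢l (proj₁ (node-injective eq))
  branch-unique n i j k with apex? i k j
  ... | yes _ = Unique.cartesianProductWith⁺ (node k) (proj₂ ∘ node-injective) (trees-unique n i k) (trees-unique n k j)
  ... | no  _ = []

  count : (n i j : ℕ) → ℕ
  count n i j = length (trees n i j)

  count-edge : ∀ n i → suc i ≤ n + i → count n i (suc i) ≡ 1
  count-edge zero i i<i = ⊥-elim (<-irrefl refl i<i)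
  count-edge (suc n) i _ with suc i ≟ suc i
  ... | yes _ = refl
  ... | no ne = ⊥-elim (ne refl)

  branchCount : (n i j k : ℕ) → ℕ
  branchCount n i j k = length (branch n i j k)

  -- This form of j says that i and j are not adjacent, which excludes the leaf and makes `suc d`
  -- the true number of candidate apexes.
  count-split : ∀ n i j d → j ≡ suc i + suc d → count (suc n) i j ≡ sumFrom (suc i) (suc d) (branchCount n i j)
  count-split n i j d refl with suc i + suc d ≟ suc i
  ... | yes eq = ⊥-elim (m+1+n≢m (suc i) eq)
  ... | no _ = trans (length-concatMap-range (branch n i j) (suc i) (i + suc d ∸ i))
                     (cong (λ m → sumFrom (suc i) m (branchCount n i j)) (m+n∸m≡n i (suc d)))

  branchCount-yes : ∀ n i j k → Apex i k j → branchCount n i j k ≡ count n i k * count n k j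
  branchCount-yes n i j k apex with apex? i k j
  ... | yes _ = length-cartesianProductWith (node k) (trees n i k) (trees n k j)
  ... | no ¬apex = ⊥-elim (¬apex apex)

  branchCount-no : ∀ n i j k → ¬ Apex i k j → branchCount n i j k ≡ 0
  branchCount-no n i j k ¬apex with apex? i k j
  ... | yes apex = ⊥-elim (¬apex apex)
  ... | no _     = refl

  -- The polygon lo..hi consists of two sides of ABC meeting in the corner m.
  record IsStrip (lo m hi : ℕ) : Set where
    field
      nearˡ : ∀ {x k y} → lo ≤ x → x < k → k ≤ m → m < y → y ≤ hi → Apex x k y → k ≡ suc x
      nearʳ : ∀ {x k y} → lo ≤ x → x < m → m ≤ k → k < y → y ≤ hi → Apex x k y → y ≡ suc k
      stepˡ : ∀ {x y} → lo ≤ x → suc x < m → m < y → y ≤ hi → Apex x (suc x) y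
      stepʳ : ∀ {x y} → lo ≤ x → x < m → m < y → suc y ≤ hi → Apex x y (suc y)
      tip   : ∀ {x} → lo ≤ x → suc x ≡ m → suc m ≤ hi → Apex x m (suc m)

  module Strip {lo m hi : ℕ} (isStrip : IsStrip lo m hi) where
    open IsStrip isStrip

    -- Each chain lies on a line, so an apex on the first chain must follow i directly and one on
    -- the second must directly precede j. The corner m lies on both and would have to satisfy both
    -- conditions, which forces p = q = 0. Every other choice shortens one chain by one point.
    strip-count : ∀ n i j p q → lo ≤ i → i + suc p ≡ m → m + suc q ≡ j → j ≤ hi → j ≤ n + i →
      count n i j ≡ paths p q
    strip-count zero i j p q _ refl refl _ j≤i =
      ⊥-elim (<⇒≱ (<-≤-trans (m<m+n i z<s) (m≤m+n (i + suc p) (suc q))) j≤i)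
    strip-count (suc n) i j p q lo≤i m≡ j≡ j≤hi fuel = begin
      count (suc n) i j
        ≡⟨ count-split n i j (p + q) (trans (sym j≡) (trans (cong (_+ suc q) (sym m≡)) (shape i p q))) ⟩
      sumFrom (suc i) (suc (p + q)) f
        ≡⟨ cong (λ d → sumFrom (suc i) d f) (sym (+-suc p q)) ⟩
      sumFrom (suc i) (p + suc q) f
        ≡⟨ sumFrom-++ (suc i) p (suc q) f ⟩
      sumFrom (suc i) p f + sumFrom (suc i + p) (suc q) f
        ≡⟨ cong (λ k → sumFrom (suc i) p f + sumFrom k (suc q) f) 1+i+p≡m ⟩
      sumFrom (suc i) p f + (f m + sumFrom (suc m) q f)
        ≡⟨ cong₂ _+_ (leftPart p m≡) (cong₂ _+_ (middle p q m≡ j≡) (rightPart q j≡)) ⟩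
      viaLeft p q + (atTip p q + viaRight p q)
        ≡⟨ paths-split p q ⟩
      paths p q ∎
      where
      open ≡-Reasoning
      f : ℕ → ℕ
      f = branchCount n i j
      1+i+p≡m : suc i + p ≡ m
      1+i+p≡m = trans (sym (+-suc i p)) m≡
      shape : ∀ i p q → i + suc p + suc q ≡ suc i + suc (p + q)
      shape = solve-∀
      i<m : i < m
      i<m = subst (i <_) m≡ (m<m+n i z<s)
      m<j : m < j
      m<j = subst (m <_) j≡ (m<m+n m z<s)

      leftPart : ∀ p → i + suc p ≡ m → sumFrom (suc i) p f ≡ viaLeft p q
      leftPart zero    _  = refl
      leftPart (suc p) m≡ = begin
        sumFrom (suc i) (suc p) f
          ≡⟨ sumFrom-first (suc i) p (λ k i<k k< → branchCount-no n i j k λ apex →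
               <⇒≢ i<k (sym (nearˡ lo≤i (<-trans (n<1+n i) i<k)
                 (<⇒≤ (subst (k <_) (trans (sym (+-suc i (suc p))) m≡) k<)) m<j j≤hi apex))) ⟩
        f (suc i)
          ≡⟨ branchCount-yes n i j (suc i) (stepˡ lo≤i 1+i<m m<j j≤hi) ⟩
        count n i (suc i) * count n (suc i) j
          ≡⟨ cong₂ _*_ (count-edge n i (fuel-left {n = n} fuel (<-trans 1+i<m m<j)))
               (strip-count n (suc i) j p q (m≤n⇒m≤1+n lo≤i) (trans (sym (+-suc i (suc p))) m≡) j≡ j≤hi
                 (fuel-right n fuel ≤-refl)) ⟩
        1 * paths p q ≡⟨ *-identityˡ _ ⟩
        paths p q ∎
        where
        1+i<m : suc i < m
        1+i<m = subst (suc i <_) (trans (sym (+-suc i (suc p))) m≡) (m<m+n (suc i) z<s)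

      rightPart : ∀ q → m + suc q ≡ j → sumFrom (suc m) q f ≡ viaRight p q
      rightPart zero    _  = refl
      rightPart (suc q) j≡ = begin
        sumFrom (suc m) (suc q) f
          ≡⟨ sumFrom-last (suc m) q (λ k m<k k< → branchCount-no n i j k λ apex →
               <⇒≢ (s≤s k<) (trans (sym (nearʳ lo≤i i<m (<⇒≤ m<k)
                 (<-trans k< (subst (suc m + q <_) j≡′ ≤-refl)) j≤hi apex)) (sym j≡′))) ⟩
        f (suc m + q)
          ≡⟨ branchCount-yes n i j (suc m + q)
               (subst (Apex i (suc m + q)) j≡′ (stepʳ lo≤i i<m (s≤s (m≤m+n m q)) (subst (_≤ hi) (sym j≡′) j≤hi))) ⟩
        count n i (suc m + q) * count n (suc m + q) j
          ≡⟨ cong₂ _*_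
               (strip-count n i (suc m + q) p q lo≤i m≡ (+-suc m q)
                 (≤-trans (<⇒≤ before) j≤hi) (fuel-left {n = n} fuel before))
               (trans (cong (count n (suc m + q)) (sym j≡′))
                 (count-edge n (suc m + q) (subst (_≤ n + (suc m + q)) (sym j≡′)
                    (fuel-right n fuel (<-trans i<m (s≤s (m≤m+n m q))))))) ⟩
        paths p q * 1 ≡⟨ *-identityʳ _ ⟩
        paths p q ∎
        where
        j≡′ : suc (suc m + q) ≡ j
        j≡′ = trans (trans (cong suc (sym (+-suc m q))) (sym (+-suc m (suc q)))) j≡
        before : suc m + q < j
        before = subst (suc m + q <_) j≡′ ≤-refl

      middle : ∀ p q → i + suc p ≡ m → m + suc q ≡ j → f m ≡ atTip p q
      middle zero zero m≡ j≡ = begin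
        f m
          ≡⟨ branchCount-yes n i j m (subst (Apex i m) 1+m≡j (tip lo≤i 1+i≡m (subst (_≤ hi) (sym 1+m≡j) j≤hi))) ⟩
        count n i m * count n m j
          ≡⟨ cong₂ _*_
               (trans (cong (count n i) (sym 1+i≡m))
                 (count-edge n i (subst (_≤ n + i) (sym 1+i≡m) (fuel-left {n = n} fuel m<j))))
               (trans (cong (count n m) (sym 1+m≡j))
                 (count-edge n m (subst (_≤ n + m) (sym 1+m≡j) (fuel-right n fuel i<m)))) ⟩
        1 ∎
        where
        1+i≡m : suc i ≡ m
        1+i≡m = trans (+-comm 1 i) m≡
        1+m≡j : suc m ≡ j
        1+m≡j = trans (+-comm 1 m) j≡
      middle (suc p) q m≡ j≡ = branchCount-no n i j m λ apex →
        m+1+n≢m (suc i) (trans (sym (+-suc i (suc p))) (trans m≡ (nearˡ lo≤i i<m ≤-refl m<j j≤hi apex)))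
      middle zero (suc q) m≡ j≡ = branchCount-no n i j m λ apex →
        m+1+n≢m (suc m) (trans (sym (+-suc m (suc q))) (trans j≡ (nearʳ lo≤i i<m ≤-refl m<j j≤hi apex)))

-- The numbers arising from the walk and their closed forms.

-- The apex runs through r consecutive points of BC, of which e precede the first.
fan : (p q e r : ℕ) → ℕ
fan p q e zero    = 0
fan p q e (suc r) = paths p e * paths r q + fan p q (suc e) r

-- Triangulations of the polygon i..j with i on AB, j on CA, where p = B − i and
-- q = j − C; central triangles are permitted iff g. The case p = q = 0 is junk.
trapezoid : (a : ℕ) → Bool → ℕ → ℕ → ℕ
trapezoid a g zero    zero    = 0
trapezoid a g zero    (suc q) = paths a q
trapezoid a g (suc p) zero    = paths p a
trapezoid a g (suc p) (suc q) =
  trapezoid a g p (suc q) + ((if g then fan p q 0 a else 0) + trapezoid a g (suc p) q)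

-- The share of `trapezoid` due to central triangles: the same recursion with zero boundary values,
-- since a strip has no central triangle, and with `fan p q 0 a` replaced by its closed form.
central : (a p q : ℕ) → ℕ
central a zero    q       = 0
central a (suc p) zero    = 0
central a (suc p) (suc q) = central a p (suc q) + (binomPred (p + q + a) a + central a (suc p) q)

module Arithmetic where

  open import Data.Nat.Combinatorics using (_C_; nCn≡1; nCk+nC[k+1]≡[n+1]C[k+1]; k>n⇒nCk≡0)
  open ≡-Reasoning

  paths-comm : ∀ p q → paths p q ≡ paths q p
  paths-comm zero    q       = sym (paths-zeroʳ q)
  paths-comm (suc p) zero    = refl
  paths-comm (suc p) (suc q) = trans (cong₂ _+_ (paths-comm p (suc q)) (paths-comm (suc p) q))
    (+-comm (paths (suc q) p) (paths q (suc p)))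

  paths≡C : ∀ p q → paths p q ≡ (p + q) C p
  paths≡C zero    q       = refl
  paths≡C (suc p) zero    = sym (trans (cong (_C suc p) (+-identityʳ (suc p))) (nCn≡1 (suc p)))
  paths≡C (suc p) (suc q) = begin
    paths p (suc q) + paths (suc p) q       ≡⟨ cong₂ _+_ (paths≡C p (suc q)) (paths≡C (suc p) q) ⟩
    (p + suc q) C p + (suc p + q) C suc p   ≡⟨ cong (λ n → (p + suc q) C p + n C suc p) (sym (+-suc p q)) ⟩
    (p + suc q) C p + (p + suc q) C suc p   ≡⟨ nCk+nC[k+1]≡[n+1]C[k+1] (p + suc q) p ⟩
    suc (p + suc q) C suc p                 ∎

  -- A hockey-stick sum: the first factor is constantly 1, and the second factors add up by the
  -- recursion of `paths`.
  fan-zero : ∀ q e r → fan 0 q e (suc r) ≡ paths (suc q) r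
  fan-zero q e zero    = refl
  fan-zero q e (suc r) = cong₂ _+_ (trans (*-identityˡ _) (paths-comm (suc r) q)) (fan-zero q (suc e) r)

  -- Pascal's rule in the first factor of each summand. The offset e is a parameter of `fan` so that
  -- this shift can be expressed.
  fan-suc : ∀ p q e r → fan (suc p) q (suc e) r ≡ fan p q (suc e) r + fan (suc p) q e r
  fan-suc p q e zero    = refl
  fan-suc p q e (suc r) = trans (cong ((paths p (suc e) + paths (suc p) e) * paths r q +_) (fan-suc p q (suc e) r))
    (shape (paths p (suc e)) (paths (suc p) e) (paths r q) _ _)
    where
    shape : ∀ x y z u v → (x + y) * z + (u + v) ≡ x * z + u + (y * z + v)
    shape = solve-∀

  -- Chu–Vandermonde in the form Σ C(p+x,p) C(q+y,q) = C(p+q+1+r,r) over x + y = r.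
  fan-closed : ∀ p q r → fan p q 0 (suc r) ≡ paths (suc (p + q)) r
  fan-closed zero    q r       = fan-zero q 0 r
  fan-closed (suc p) q zero    = refl
  fan-closed (suc p) q (suc r) = begin
    1 * paths (suc r) q + fan (suc p) q 1 (suc r)
      ≡⟨ cong (1 * paths (suc r) q +_) (fan-suc p q 0 (suc r)) ⟩
    1 * paths (suc r) q + (fan p q 1 (suc r) + fan (suc p) q 0 (suc r))
      ≡⟨ sym (+-assoc (1 * paths (suc r) q) _ _) ⟩
    1 * paths (suc r) q + fan p q 1 (suc r) + fan (suc p) q 0 (suc r)
      -- The summand with e = 0 does not depend on p, as `paths p 0` is 1; it completes `fan p q 1`
      -- to a full sum starting at 0.
      ≡⟨ cong₂ _+_ (trans (cong (λ x → x * paths (suc r) q + fan p q 1 (suc r)) (sym (paths-zeroʳ p)))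
                          (fan-closed p q (suc r)))
                   (fan-closed (suc p) q r) ⟩
    paths (suc (p + q)) (suc r) + paths (suc (suc p + q)) r ∎

  fan≡binomPred : ∀ p q a → fan p q 0 a ≡ binomPred (p + q + a) a
  fan≡binomPred p q zero    = refl
  fan≡binomPred p q (suc r) = begin
    fan p q 0 (suc r)         ≡⟨ fan-closed p q r ⟩
    paths (suc (p + q)) r     ≡⟨ paths-comm (suc (p + q)) r ⟩
    paths r (suc (p + q))     ≡⟨ paths≡C r (suc (p + q)) ⟩
    (r + suc (p + q)) C r     ≡⟨ cong (_C r) (shape p q r) ⟩
    (p + q + suc r) C r       ∎
    where
    shape : ∀ p q r → r + suc (p + q) ≡ p + q + suc r
    shape = solve-∀

  binomPred-suc : ∀ m x → binomPred (suc m) (suc x) ≡ binomPred m x + binomPred m (suc x)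
  binomPred-suc m zero    = refl
  binomPred-suc m (suc x) = sym (nCk+nC[k+1]≡[n+1]C[k+1] m x)

  bsum-suc : ∀ m k → bsum m (suc k) ≡ bsum m k + m C k
  bsum-suc m k = begin
    sum (map (m C_) (upTo (suc k)))          ≡⟨ cong (λ xs → sum (map (m C_) xs)) (sym (upTo-∷ʳ k)) ⟩
    sum (map (m C_) (upTo k ++ (k ∷ [])))    ≡⟨ cong sum (map-++ (m C_) (upTo k) (k ∷ [])) ⟩
    sum (map (m C_) (upTo k) ++ (m C k ∷ [])) ≡⟨ sum-++ (map (m C_) (upTo k)) (m C k ∷ []) ⟩
    bsum m k + (m C k + 0)                   ≡⟨ cong (bsum m k +_) (+-identityʳ _) ⟩
    bsum m k + m C k                         ∎

  -- Passes between the sums of the total count and those of the T-count, which have one more term.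
  -- At k = 0 both sums are empty and the truncated predecessor does no harm.
  bsum-pred : ∀ m k → bsum m (k ∸ 1) + binomPred m k ≡ bsum m k
  bsum-pred m zero    = refl
  bsum-pred m (suc k) = sym (bsum-suc m k)

  bsum-pascal : ∀ m k → bsum (suc m) k ≡ bsum m k + bsum m (k ∸ 1)
  bsum-pascal m zero          = refl
  bsum-pascal m (suc zero)    = refl
  bsum-pascal m (suc (suc k)) = begin
    bsum (suc m) (suc (suc k))                             ≡⟨ bsum-suc (suc m) (suc k) ⟩
    bsum (suc m) (suc k) + suc m C suc k
      ≡⟨ cong₂ _+_ (bsum-pascal m (suc k)) (sym (nCk+nC[k+1]≡[n+1]C[k+1] m k)) ⟩
    bsum m (suc k) + bsum m k + (m C k + m C suc k)        ≡⟨ shape (bsum m (suc k)) _ _ _ ⟩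
    bsum m (suc k) + m C suc k + (bsum m k + m C k)
      ≡⟨ cong₂ _+_ (sym (bsum-suc m (suc k))) (sym (bsum-suc m k)) ⟩
    bsum m (suc (suc k)) + bsum m (suc k)                  ∎
    where
    shape : ∀ x y u v → x + y + (u + v) ≡ x + v + (y + u)
    shape = solve-∀

  double : ∀ x → x + x ≡ x + (x + 0)
  double x = cong (x +_) (sym (+-identityʳ x))

  bsum-full : ∀ m → bsum m (suc m) ≡ 2 ^ m
  bsum-full zero    = refl
  bsum-full (suc m) = begin
    bsum (suc m) (suc (suc m))               ≡⟨ bsum-pascal m (suc (suc m)) ⟩
    bsum m (suc (suc m)) + bsum m (suc m)    ≡⟨ cong (_+ bsum m (suc m)) (begin
        bsum m (suc (suc m))                    ≡⟨ bsum-suc m (suc m) ⟩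
        bsum m (suc m) + m C suc m              ≡⟨ cong (bsum m (suc m) +_) (k>n⇒nCk≡0 (n<1+n m)) ⟩
        bsum m (suc m) + 0                      ≡⟨ +-identityʳ _ ⟩
        bsum m (suc m)                          ∎) ⟩
    bsum m (suc m) + bsum m (suc m)          ≡⟨ cong (λ x → x + x) (bsum-full m) ⟩
    2 ^ m + 2 ^ m                            ≡⟨ double (2 ^ m) ⟩
    2 ^ suc m                                ∎

  -- By the symmetry of row m, the first y entries have the same sum as the last y, which together
  -- with the first x fill the row. Induction by Pascal's rule replaces the reflection of the index.
  bsum-complement : ∀ m x y → x + y ≡ suc m → bsum m x + bsum m y ≡ 2 ^ m
  bsum-complement m zero y refl = bsum-full m
  bsum-complement m (suc x) zero eq = trans (+-identityʳ _)
    (trans (cong (bsum m) (trans (sym (+-identityʳ (suc x))) eq)) (bsum-full m))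
  bsum-complement zero (suc x) (suc y) eq with () ← trans (sym (+-suc x y)) (suc-injective eq)
  bsum-complement (suc m) (suc x) (suc y) eq = begin
    bsum (suc m) (suc x) + bsum (suc m) (suc y)
      ≡⟨ cong₂ _+_ (bsum-pascal m (suc x)) (bsum-pascal m (suc y)) ⟩
    bsum m (suc x) + bsum m x + (bsum m (suc y) + bsum m y)
      ≡⟨ shape (bsum m (suc x)) _ _ _ ⟩
    bsum m (suc x) + bsum m y + (bsum m x + bsum m (suc y))
      ≡⟨ cong₂ _+_ (bsum-complement m (suc x) y (trans (sym (+-suc x y)) (suc-injective eq)))
                   (bsum-complement m x (suc y) (suc-injective eq)) ⟩
    2 ^ m + 2 ^ m ≡⟨ double (2 ^ m) ⟩
    2 ^ suc m ∎
    where
    shape : ∀ x y u v → x + y + (u + v) ≡ x + v + (y + u)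
    shape = solve-∀

  -- If p or q is 0, `central` vanishes and the two remaining sums are complementary. Otherwise
  -- Pascal's rule splits each of the three sums, and the fan term is exactly what `bsum m (a ∸ 1)`
  -- lacks to be `bsum m a`; the pieces then form two instances in row m.
  central-closed : ∀ m a p q → p + q + a ≡ suc m → central a p q + bsum m a + bsum m p + bsum m q ≡ 2 ^ m
  central-closed m a zero q eq = trans (cong (_+ bsum m q) (+-identityʳ _))
    (bsum-complement m a q (trans (+-comm a q) eq))
  central-closed m a (suc p) zero eq = trans (+-identityʳ _)
    (bsum-complement m a (suc p) (trans (+-comm a (suc p)) (trans (cong (_+ a) (sym (+-identityʳ (suc p)))) eq)))
  central-closed zero a (suc p) (suc q) eq with () ← trans (cong (_+ a) (sym (+-suc p q))) (suc-injective eq)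
  central-closed (suc m) a (suc p) (suc q) eq = begin
    central a p (suc q) + (binomPred (p + q + a) a + central a (suc p) q)
      + bsum (suc m) a + bsum (suc m) (suc p) + bsum (suc m) (suc q)
      ≡⟨ cong (λ k → central a p (suc q) + (binomPred k a + central a (suc p) q)
           + bsum (suc m) a + bsum (suc m) (suc p) + bsum (suc m) (suc q)) p+q+a≡m ⟩
    central a p (suc q) + (binomPred m a + central a (suc p) q)
      + bsum (suc m) a + bsum (suc m) (suc p) + bsum (suc m) (suc q)
      ≡⟨ cong₂ _+_ (cong₂ _+_ (cong (central a p (suc q) + (binomPred m a + central a (suc p) q) +_)
           (bsum-pascal m a)) (bsum-pascal m (suc p))) (bsum-pascal m (suc q)) ⟩
    central a p (suc q) + (binomPred m a + central a (suc p) q)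
      + (bsum m a + bsum m (a ∸ 1)) + (bsum m (suc p) + bsum m p) + (bsum m (suc q) + bsum m q)
      ≡⟨ shape (central a p (suc q)) (binomPred m a) (central a (suc p) q) (bsum m a) (bsum m (a ∸ 1))
           (bsum m (suc p)) (bsum m p) (bsum m (suc q)) (bsum m q) ⟩
    (central a p (suc q) + (bsum m (a ∸ 1) + binomPred m a) + bsum m p + bsum m (suc q))
      + (central a (suc p) q + bsum m a + bsum m (suc p) + bsum m q)
      ≡⟨ cong (λ x → (central a p (suc q) + x + bsum m p + bsum m (suc q))
           + (central a (suc p) q + bsum m a + bsum m (suc p) + bsum m q)) (bsum-pred m a) ⟩
    (central a p (suc q) + bsum m a + bsum m p + bsum m (suc q))
      + (central a (suc p) q + bsum m a + bsum m (suc p) + bsum m q)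
      ≡⟨ cong₂ _+_ (central-closed m a p (suc q) (suc-injective eq))
           (central-closed m a (suc p) q (cong suc p+q+a≡m)) ⟩
    2 ^ m + 2 ^ m ≡⟨ double (2 ^ m) ⟩
    2 ^ suc m ∎
    where
    p+q+a≡m : p + q + a ≡ m
    p+q+a≡m = suc-injective (trans (cong (_+ a) (sym (+-suc p q))) (suc-injective eq))
    shape : ∀ x β y s s′ u u′ v v′ → x + (β + y) + (s + s′) + (u + u′) + (v + v′)
      ≡ (x + (s′ + β) + u′ + v) + (y + s + u + v′)
    shape = solve-∀

  if-zero : ∀ g → (if g then 0 else 0) ≡ 0
  if-zero true  = refl
  if-zero false = refl

  -- The recursion is linear. Its boundary values are single binomials, which Pascal's rule carries
  -- inward, while the fan terms accumulate to `central`. The recursion never reaches the excluded p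
  -- = q = 0.
  trapezoid-closed : ∀ m a g p q → 0 < p + q → p + q + a ≡ suc m →
    trapezoid a g p q ≡ binomPred m p + binomPred m q + (if g then central a p q else 0)
  trapezoid-closed m a g zero zero () eq
  trapezoid-closed m a g zero (suc q) _ refl = begin
    paths a q                             ≡⟨ paths-comm a q ⟩
    paths q a                             ≡⟨ paths≡C q a ⟩
    (q + a) C q                           ≡⟨ sym (+-identityʳ _) ⟩
    (q + a) C q + 0                       ≡⟨ cong ((q + a) C q +_) (sym (if-zero g)) ⟩
    (q + a) C q + (if g then 0 else 0)    ∎
  trapezoid-closed m a g (suc p) zero _ eq = begin
    paths p a                                 ≡⟨ paths≡C p a ⟩
    (p + a) C p                               ≡⟨ cong (_C p) (suc-injective
                                                   (trans (cong (λ x → suc (x + a)) (sym (+-identityʳ p))) eq)) ⟩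
    m C p                                     ≡⟨ sym (trans (+-identityʳ _) (+-identityʳ _)) ⟩
    m C p + 0 + 0                             ≡⟨ cong (m C p + 0 +_) (sym (if-zero g)) ⟩
    m C p + 0 + (if g then 0 else 0)          ∎
  trapezoid-closed zero a g (suc p) (suc q) _ eq with () ← trans (cong (_+ a) (sym (+-suc p q))) (suc-injective eq)
  trapezoid-closed (suc m) a g (suc p) (suc q) _ eq = begin
    trapezoid a g p (suc q) + ((if g then fan p q 0 a else 0) + trapezoid a g (suc p) q)
      ≡⟨ cong₂ _+_ (trapezoid-closed m a g p (suc q) (subst (0 <_) (sym (+-suc p q)) z<s) (suc-injective eq))
           (cong₂ _+_ (cong (λ x → if g then x else 0) (trans (fan≡binomPred p q a) (cong (λ k → binomPred k a) p+q+a≡m)))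
                      (trapezoid-closed m a g (suc p) q z<s (cong suc p+q+a≡m))) ⟩
    binomPred m p + binomPred m (suc q) + (if g then central a p (suc q) else 0)
      + ((if g then binomPred m a else 0)
        + (binomPred m (suc p) + binomPred m q + (if g then central a (suc p) q else 0)))
      ≡⟨ shape (binomPred m p) (binomPred m (suc q)) (if g then central a p (suc q) else 0)
           (if g then binomPred m a else 0) (binomPred m (suc p)) (binomPred m q) (if g then central a (suc p) q else 0) ⟩
    (binomPred m p + binomPred m (suc p)) + (binomPred m q + binomPred m (suc q))
      + ((if g then central a p (suc q) else 0) + ((if g then binomPred m a else 0) + (if g then central a (suc p) q else 0)))
      ≡⟨ cong₂ _+_ (cong₂ _+_ (sym (binomPred-suc m p)) (sym (binomPred-suc m q))) (collect g) ⟩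
    binomPred (suc m) (suc p) + binomPred (suc m) (suc q) + (if g then central a (suc p) (suc q) else 0) ∎
    where
    p+q+a≡m : p + q + a ≡ m
    p+q+a≡m = suc-injective (trans (cong (_+ a) (sym (+-suc p q))) (suc-injective eq))
    shape : ∀ x y u v z w t → x + y + u + (v + (z + w + t)) ≡ (x + z) + (w + y) + (u + (v + t))
    shape = solve-∀
    collect : ∀ g → (if g then central a p (suc q) else 0)
        + ((if g then binomPred m a else 0) + (if g then central a (suc p) q else 0))
      ≡ (if g then central a (suc p) (suc q) else 0)
    collect true  = cong (λ k → central a p (suc q) + (binomPred k a + central a (suc p) q)) (sym p+q+a≡m)
    collect false = refl

  -- Needed when CA has no inner points and the whole polygon is one strip: Pascal's rule, with one
  -- of the two binomials reflected.
  paths-binomPred : ∀ m p q → p + q ≡ suc m → paths p q ≡ binomPred m q + binomPred m p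
  paths-binomPred m zero    (suc q) refl = sym (trans (+-identityʳ _) (nCn≡1 m))
  paths-binomPred m (suc p) zero    eq   = sym (trans (cong (_C p) (trans (suc-injective (sym eq)) (+-identityʳ p))) (nCn≡1 p))
  paths-binomPred m (suc p) (suc q) eq   = begin
    paths p (suc q) + paths (suc p) q
      ≡⟨ cong₂ _+_ (paths≡C p (suc q)) (trans (paths-comm (suc p) q) (paths≡C q (suc p))) ⟩
    (p + suc q) C p + (q + suc p) C q
      ≡⟨ cong₂ (λ x y → x C p + y C q) (suc-injective eq)
           (trans (+-suc q p) (trans (cong suc (+-comm q p)) (trans (sym (+-suc p q)) (suc-injective eq)))) ⟩
    m C p + m C q  ≡⟨ +-comm (m C p) (m C q) ⟩
    m C q + m C p  ∎

  central-zeroʳ : ∀ a p → central a p 0 ≡ 0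
  central-zeroʳ a zero    = refl
  central-zeroʳ a (suc p) = refl

open Arithmetic

-- The geometry of the triangle and the walk from A.

module Triangle (a b c : ℕ) where

  B C L : ℕ
  B = c + 1
  C = c + a + 2
  L = a + b + c + 2

  B+1+a≡C : B + suc a ≡ C
  B+1+a≡C = shape c a
    where
    shape : ∀ c a → c + 1 + suc a ≡ c + a + 2
    shape = solve-∀

  C+b≡L : C + b ≡ L
  C+b≡L = shape a b c
    where
    shape : ∀ a b c → c + a + 2 + b ≡ a + b + c + 2
    shape = solve-∀

  B<C : B < C
  B<C = subst (B <_) B+1+a≡C (m<m+n B z<s)

  C≤L : C ≤ L
  C≤L = subst (C ≤_) C+b≡L (m≤m+n C b)

  0<B : 0 < B
  0<B = m≤n+m 1 c

  A : ℕ → ℕ → Set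
  A = Allowed a b c

  sameSide? : ∀ i j → Dec (SameSide a b c i j)
  sameSide? i j = ((i ≤? B) ×-dec (j ≤? B))
    ⊎-dec ((((B ≤? i) ×-dec (i ≤? C)) ×-dec ((B ≤? j) ×-dec (j ≤? C)))
    ⊎-dec (((C ≤? i) ⊎-dec (i ≟ 0)) ×-dec ((C ≤? j) ⊎-dec (j ≟ 0))))

  A? : ∀ i j → Dec (A i j)
  A? i j = ¬? (sameSide? i j)

  private variable
    i j k x y : ℕ

  ¬allowed-AB : x ≤ B → y ≤ B → ¬ A x y
  ¬allowed-AB x≤B y≤B a = a (inj₁ (x≤B , y≤B))

  ¬allowed-BC : B ≤ x → x ≤ C → B ≤ y → y ≤ C → ¬ A x y
  ¬allowed-BC B≤x x≤C B≤y y≤C a = a (inj₂ (inj₁ ((B≤x , x≤C) , (B≤y , y≤C))))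

  ¬allowed-CA : C ≤ x ⊎ x ≡ 0 → C ≤ y ⊎ y ≡ 0 → ¬ A x y
  ¬allowed-CA x∈ y∈ a = a (inj₂ (inj₂ (x∈ , y∈)))

  allowed-AB-BC : x < B → B < y → y ≤ C → 0 < x ⊎ y < C → A x y
  allowed-AB-BC x<B B<y y≤C _ (inj₁ (_ , y≤B)) = <⇒≱ B<y y≤B
  allowed-AB-BC x<B B<y y≤C _ (inj₂ (inj₁ ((B≤x , _) , _))) = <⇒≱ x<B B≤x
  allowed-AB-BC x<B B<y y≤C _ (inj₂ (inj₂ (inj₁ C≤x , _))) = <⇒≱ (<-trans x<B B<C) C≤x
  allowed-AB-BC x<B B<y y≤C (inj₁ ()) (inj₂ (inj₂ (inj₂ refl , _)))
  allowed-AB-BC x<B B<y y≤C (inj₂ y<C) (inj₂ (inj₂ (inj₂ refl , inj₁ C≤y))) = <⇒≱ y<C C≤y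
  allowed-AB-BC x<B () y≤C (inj₂ y<C) (inj₂ (inj₂ (inj₂ refl , inj₂ refl)))

  allowed-BC-CA : B ≤ x → x < C → C < y → A x y
  allowed-BC-CA B≤x x<C C<y (inj₁ (_ , y≤B)) = <⇒≱ (<-trans B<C C<y) y≤B
  allowed-BC-CA B≤x x<C C<y (inj₂ (inj₁ (_ , (_ , y≤C)))) = <⇒≱ C<y y≤C
  allowed-BC-CA B≤x x<C C<y (inj₂ (inj₂ (inj₁ C≤x , _))) = <⇒≱ x<C C≤x
  allowed-BC-CA B≤x x<C C<y (inj₂ (inj₂ (inj₂ refl , _))) = <⇒≱ 0<B B≤x

  allowed-AB-CA : 0 < x → x ≤ B → C < y → A x y
  allowed-AB-CA 0<x x≤B C<y (inj₁ (_ , y≤B)) = <⇒≱ (<-trans B<C C<y) y≤B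
  allowed-AB-CA 0<x x≤B C<y (inj₂ (inj₁ (_ , (_ , y≤C)))) = <⇒≱ C<y y≤C
  allowed-AB-CA 0<x x≤B C<y (inj₂ (inj₂ (inj₁ C≤x , _))) = <⇒≱ B<C (≤-trans C≤x x≤B)
  allowed-AB-CA () x≤B C<y (inj₂ (inj₂ (inj₂ refl , _)))

  -- If k and j were on AB, so would be i, and i, j would be neither admissible nor the base. In the
  -- other cases the side through k and j misses i, so i may be joined to k+1, whereas all points
  -- from k to j lie on that one side.
  degenerate : A i j ⊎ (i ≡ 0 × j ≡ L) → k ≡ suc i ⊎ A i k → i < k → suc k < j → j ≤ L →
    ¬ A k j → A i (suc k) × (∀ q → k < q → q ≤ j → ¬ A k q)
  degenerate {i} {j} {k} s ok i<k 1+k<j j≤L ¬a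
    with decidable-stable (sameSide? k j) ¬a
  degenerate {i} {j} {k} (inj₁ aij) ok i<k 1+k<j j≤L ¬a | inj₁ (k≤B , j≤B) =
    ⊥-elim (¬allowed-AB (≤-trans (<⇒≤ i<k) k≤B) j≤B aij)
  degenerate {i} {j} {k} (inj₂ (refl , refl)) ok i<k 1+k<j j≤L ¬a | inj₁ (k≤B , j≤B) =
    ⊥-elim (<⇒≱ (<-≤-trans B<C C≤L) j≤B)
  degenerate {i} {j} {k} s ok i<k 1+k<j j≤L ¬a | inj₂ (inj₁ ((B≤k , k≤C) , (B≤j , j≤C))) =
    allowed-AB-BC (i<B s) (s≤s B≤k) (<⇒≤ 1+k<C) (inj₂ 1+k<C)
    , λ q k<q q≤j → ¬allowed-BC B≤k k≤C (≤-trans B≤k (<⇒≤ k<q)) (≤-trans q≤j j≤C)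
    where
    1+k<C : suc k < C
    1+k<C = <-≤-trans 1+k<j j≤C
    i<B : A i j ⊎ (i ≡ 0 × j ≡ L) → i < B
    i<B (inj₁ aij) = ≰⇒> λ B≤i → ¬allowed-BC B≤i (≤-trans (<⇒≤ i<k) k≤C) B≤j j≤C aij
    i<B (inj₂ (refl , _)) = 0<B
  degenerate {i} {j} {k} s ok i<k 1+k<j j≤L ¬a | inj₂ (inj₂ (inj₂ refl , _)) = ⊥-elim (n≮0 i<k)
  degenerate {i} {j} {k} s ok i<k 1+k<j j≤L ¬a | inj₂ (inj₂ (inj₁ C≤k , _)) =
    allowed
    , λ q k<q q≤j → ¬allowed-CA (inj₁ C≤k) (inj₁ (≤-trans C≤k (<⇒≤ k<q)))
    where
    i∉CA : A i j ⊎ (i ≡ 0 × j ≡ L) → k ≡ suc i ⊎ A i k → ¬ (C ≤ i ⊎ i ≡ 0)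
    i∉CA (inj₁ aij) _ i∈ = ¬allowed-CA i∈ (inj₁ (≤-trans C≤k (<⇒≤ (<-trans ≤-refl 1+k<j)))) aij
    -- For the base, i is the corner A, which does lie on CA. Here the contradiction comes from the
    -- side A, k: a point k on CA is neither adjacent to A in the numbering nor admissible.
    i∉CA (inj₂ (refl , _)) (inj₁ refl) _ = <⇒≱ (≤-<-trans 0<B B<C) C≤k
    i∉CA (inj₂ (refl , _)) (inj₂ aik) i∈ = ¬allowed-CA i∈ (inj₁ C≤k) aik
    allowed : A i (suc k)
    allowed with i ≤? B
    ... | yes i≤B = allowed-AB-CA (n≢0⇒n>0 (i∉CA s ok ∘ inj₂)) i≤B (s≤s C≤k)
    ... | no  i≰B = allowed-BC-CA (<⇒≤ (≰⇒> i≰B)) (≰⇒> (i∉CA s ok ∘ inj₁)) (s≤s C≤k)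

  Central : ℕ → ℕ → ℕ → Set
  Central i k j = InAB a b c i × InBC a b c k × InCA a b c j

  module Counting (g : Bool) where

    -- g = false singles out the D-triangulations, g = true all triangulations.
    Good : ℕ → ℕ → ℕ → Set
    Good i k j = ¬ Central i k j ⊎ T g

    good? : ∀ i k j → Dec (Good i k j)
    good? i k j = ¬? (((1 ≤? i) ×-dec (i ≤? c))
                 ×-dec (((c + 2 ≤? k) ×-dec (k ≤? c + a + 1)) ×-dec (c + a + 3 ≤? j)))
             ⊎-dec T? g

    open Polygon A A? Good good? public
    open Enumeration A A? Good good? public

    good-AB : B ≤ i → Good i k j
    good-AB B≤i = inj₁ λ { ((_ , i≤c) , _) → <⇒≱ (≤-reflexive (+-comm 1 c)) (≤-trans B≤i i≤c) }

    good-BC : k ≤ B ⊎ C ≤ k → Good i k j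
    good-BC (inj₁ k≤B) = inj₁ λ { (_ , (c+2≤k , _) , _) → <⇒≱ (≤-trans (≤-reflexive (sym (+-suc c 1))) c+2≤k) k≤B }
    good-BC (inj₂ C≤k) = inj₁ λ { (_ , (_ , k≤c+a+1) , _) →
      <⇒≱ (≤-reflexive (sym (+-suc (c + a) 1))) (≤-trans C≤k k≤c+a+1) }

    good-CA : j ≤ C → Good i k j
    good-CA j≤C = inj₁ λ { (_ , _ , c+a+3≤j) → <⇒≱ (≤-trans (≤-reflexive (sym (+-suc (c + a) 2))) c+a+3≤j) j≤C }

    -- No vertex is inside CA, so the value of `g` is irrelevant. The pair A, C, which lies on a
    -- side, can occur only as the base and is never tested.
    strip-B : IsStrip 0 B C
    strip-B = record
      { nearˡ = λ { _ x<k k≤B _ _ (inj₁ eq , _) → eq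
                  ; _ x<k k≤B _ _ (inj₂ a , _) → ⊥-elim (¬allowed-AB (≤-trans (<⇒≤ x<k) k≤B) k≤B a) }
      ; nearʳ = λ { _ _ B≤k k<y y≤C (_ , inj₁ eq , _) → eq
                  ; _ _ B≤k k<y y≤C (_ , inj₂ a , _) →
                      ⊥-elim (¬allowed-BC B≤k (≤-trans (<⇒≤ k<y) y≤C) (≤-trans B≤k (<⇒≤ k<y)) y≤C a) }
      ; stepˡ = λ _ 1+x<B B<y y≤C → inj₁ refl , inj₂ (allowed-AB-BC 1+x<B B<y y≤C (inj₁ z<s)) , good-CA y≤C
      ; stepʳ = λ _ x<B B<y 1+y≤C →
          inj₂ (allowed-AB-BC x<B B<y (<⇒≤ 1+y≤C) (inj₂ 1+y≤C)) , inj₁ refl , good-CA 1+y≤C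
      ; tip   = λ _ 1+x≡B 1+B≤C → inj₁ (sym 1+x≡B) , inj₁ refl , good-CA 1+B≤C
      }

    strip-C : IsStrip B C L
    strip-C = record
      { nearˡ = λ { _ x<k k≤C _ _ (inj₁ eq , _) → eq
                  ; B≤x x<k k≤C _ _ (inj₂ a , _) →
                      ⊥-elim (¬allowed-BC B≤x (≤-trans (<⇒≤ x<k) k≤C) (≤-trans B≤x (<⇒≤ x<k)) k≤C a) }
      ; nearʳ = λ { _ _ C≤k k<y _ (_ , inj₁ eq , _) → eq
                  ; _ _ C≤k k<y _ (_ , inj₂ a , _) →
                      ⊥-elim (¬allowed-CA (inj₁ C≤k) (inj₁ (≤-trans C≤k (<⇒≤ k<y))) a) }
      ; stepˡ = λ B≤x 1+x<C C<y _ →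
          inj₁ refl , inj₂ (allowed-BC-CA (m≤n⇒m≤1+n B≤x) 1+x<C C<y) , good-AB B≤x
      ; stepʳ = λ B≤x x<C C<y _ → inj₂ (allowed-BC-CA B≤x x<C C<y) , inj₁ refl , good-AB B≤x
      ; tip   = λ B≤x 1+x≡C _ → inj₁ (sym 1+x≡C) , inj₁ refl , good-AB B≤x
      }

    -- The candidate apexes are cut at B and C. Here i = 0 is permitted, so that the start of the
    -- walk at A and its continuation share this decomposition.
    module Split (n i j p q : ℕ)
      (i≡ : i + suc p ≡ B) (j≡ : C + suc q ≡ j) (j≤L : j ≤ L) (fuel : j ≤ suc n + i) where

      f : ℕ → ℕ
      f = branchCount n i j

      open ≡-Reasoning

      1+i+p≡B : suc i + p ≡ B
      1+i+p≡B = trans (sym (+-suc i p)) i≡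

      1+i≤B : suc i ≤ B
      1+i≤B = subst (suc i ≤_) 1+i+p≡B (m≤m+n (suc i) p)

      C<j : C < j
      C<j = subst (C <_) j≡ (m<m+n C z<s)

      1+i<j : suc i < j
      1+i<j = ≤-<-trans 1+i≤B (<-trans B<C C<j)

      split : count (suc n) i j ≡
        sumFrom (suc i) (suc p) f + (sumFrom (suc B) a f + sumFrom C (suc q) f)
      split = begin
        count (suc n) i j
          ≡⟨ count-split n i j (p + (a + suc q)) (trans (sym j≡) (trans (cong (_+ suc q)
               (trans (sym B+1+a≡C) (cong (_+ suc a) (sym i≡)))) (shape i p a q))) ⟩
        sumFrom (suc i) (suc p + (a + suc q)) f
          ≡⟨ sumFrom-++ (suc i) (suc p) (a + suc q) f ⟩
        sumFrom (suc i) (suc p) f + sumFrom (suc i + suc p) (a + suc q) f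
          ≡⟨ cong (λ k → sumFrom (suc i) (suc p) f + sumFrom k (a + suc q) f) (cong suc i≡) ⟩
        sumFrom (suc i) (suc p) f + sumFrom (suc B) (a + suc q) f
          ≡⟨ cong (sumFrom (suc i) (suc p) f +_) (sumFrom-++ (suc B) a (suc q) f) ⟩
        sumFrom (suc i) (suc p) f + (sumFrom (suc B) a f + sumFrom (suc B + a) (suc q) f)
          ≡⟨ cong (λ k → sumFrom (suc i) (suc p) f + (sumFrom (suc B) a f + sumFrom k (suc q) f))
               (trans (sym (+-suc B a)) B+1+a≡C) ⟩
        sumFrom (suc i) (suc p) f + (sumFrom (suc B) a f + sumFrom C (suc q) f) ∎
        where
        shape : ∀ i p a q → i + suc p + suc a + suc q ≡ suc i + suc (p + (a + suc q))
        shape = solve-∀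

      left-part : sumFrom (suc i) (suc p) f ≡ count n (suc i) j
      left-part = begin
        sumFrom (suc i) (suc p) f
          ≡⟨ sumFrom-first (suc i) p (λ k i<k k< → branchCount-no n i j k (not-apex i<k
               (s≤s⁻¹ (subst (k <_) (trans (+-suc (suc i) p) (cong suc 1+i+p≡B)) k<)))) ⟩
        f (suc i)
          ≡⟨ branchCount-yes n i j (suc i)
               (inj₁ refl , inj₂ (allowed-AB-CA z<s 1+i≤B C<j) , good-BC (inj₁ 1+i≤B)) ⟩
        count n i (suc i) * count n (suc i) j
          ≡⟨ cong (_* count n (suc i) j) (count-edge n i (fuel-left {n = n} fuel 1+i<j)) ⟩
        1 * count n (suc i) j ≡⟨ *-identityˡ _ ⟩
        count n (suc i) j ∎
        where
        not-apex : ∀ {k} → suc i < k → k ≤ B → ¬ Apex i k j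
        not-apex i<k k≤B (inj₁ refl , _) = <-irrefl refl i<k
        not-apex i<k k≤B (inj₂ a , _) = ¬allowed-AB (≤-trans (n≤1+n i) 1+i≤B) k≤B a

      middle-fan : (∀ k → Good i k j) → sumFrom (suc B) a f ≡ fan p q 0 a
      middle-fan good = go (suc B) 0 a (+-comm B 1) (trans (sym (+-suc B a)) B+1+a≡C)
        where
        go : ∀ k e r → B + suc e ≡ k → k + r ≡ C → sumFrom k r f ≡ fan p q e r
        go k e zero    _  _  = refl
        go k e (suc r) k≡ k+ = cong₂ _+_ (begin
          f k
            ≡⟨ branchCount-yes n i j k
                 (inj₂ (allowed-AB-BC 1+i≤B B<k (<⇒≤ k<C) (inj₂ k<C))
                 , inj₂ (allowed-BC-CA (<⇒≤ B<k) k<C C<j) , good k) ⟩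
          count n i k * count n k j
            ≡⟨ cong₂ _*_
                 (Strip.strip-count strip-B n i k p e z≤n i≡ k≡ (<⇒≤ k<C) (fuel-left {n = n} fuel (<-trans k<C C<j)))
                 (Strip.strip-count strip-C n k j r q (<⇒≤ B<k) k+ j≡ j≤L (fuel-right n fuel (<-trans 1+i≤B B<k))) ⟩
          paths p e * paths r q ∎)
          (go (suc k) (suc e) r (trans (+-suc B (suc e)) (cong suc k≡)) (trans (sym (+-suc k r)) k+))
          where
          B<k : B < k
          B<k = subst (B <_) k≡ (m<m+n B z<s)
          k<C : k < C
          k<C = subst (k <_) k+ (m<m+n k z<s)

      -- Once i has left A, both i and j are inside their sides, so every apex inside BC creates a
      -- central triangle.
      middle-zero : 0 < i → g ≡ false → sumFrom (suc B) a f ≡ 0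
      middle-zero 0<i refl = sumFrom-zero (suc B) a λ k B<k k< → branchCount-no n i j k λ
        { (_ , _ , inj₁ ¬central) → ¬central
            ( (0<i , s≤s⁻¹ (≤-trans 1+i≤B (≤-reflexive (+-comm c 1))))
            , (≤-trans (≤-reflexive (+-suc c 1)) B<k
              , s≤s⁻¹ (≤-trans k< (≤-reflexive (trans (trans (sym (+-suc B a)) B+1+a≡C) (+-suc (c + a) 1)))))
            , ≤-trans (≤-reflexive (+-suc (c + a) 2)) C<j)
        ; (_ , _ , inj₂ ()) }

      not-apex-CA : ∀ {k} → C ≤ k → suc k < j → ¬ Apex i k j
      not-apex-CA C≤k 1+k<j (_ , inj₁ refl , _) = <-irrefl refl 1+k<j
      not-apex-CA C≤k 1+k<j (_ , inj₂ a , _) =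
        ¬allowed-CA (inj₁ C≤k) (inj₁ (<⇒≤ C<j)) a

      1+C+q≡j : suc (C + q) ≡ j
      1+C+q≡j = trans (sym (+-suc C q)) j≡

      right-part : 0 < i → sumFrom C (suc q) f ≡ count n i (C + q)
      right-part 0<i = begin
        sumFrom C (suc q) f
          ≡⟨ sumFrom-last C q (λ k C≤k k< → branchCount-no n i j k
               (not-apex-CA C≤k (subst (suc k <_) 1+C+q≡j (s≤s k<)))) ⟩
        f (C + q)
          ≡⟨ branchCount-yes n i j (C + q)
               (inj₂ (allowed q) , inj₁ (sym 1+C+q≡j) , good-BC (inj₂ (m≤m+n C q))) ⟩
        count n i (C + q) * count n (C + q) j
          ≡⟨ cong (count n i (C + q) *_) (trans (cong (count n (C + q)) (sym 1+C+q≡j))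
               (count-edge n (C + q) (subst (_≤ n + (C + q)) (sym 1+C+q≡j)
                 (fuel-right n fuel (<-≤-trans (<-trans 1+i≤B B<C) (m≤m+n C q)))))) ⟩
        count n i (C + q) * 1 ≡⟨ *-identityʳ _ ⟩
        count n i (C + q) ∎
        where
        allowed : ∀ q → A i (C + q)
        -- For q = 0 the apex is the corner C itself; the diagonal from i to C is admissible because
        -- i is not A.
        allowed zero = subst (A i) (sym (+-identityʳ C)) (allowed-AB-BC 1+i≤B B<C ≤-refl (inj₁ 0<i))
        allowed (suc q) = allowed-AB-CA 0<i (<⇒≤ 1+i≤B) (m<m+n C z<s)

      right-zero : i ≡ 0 → sumFrom C (suc q) f ≡ 0
      right-zero refl = sumFrom-zero C (suc q) λ k C≤k k< → branchCount-no n i j k λ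
        { (inj₁ refl , _) → <⇒≱ (≤-<-trans 0<B B<C) C≤k
        ; (inj₂ a , _) → ¬allowed-CA (inj₂ refl) (inj₁ C≤k) a }

    -- The hypothesis i > 0 is essential: from A the walk cannot move along CA, and an apex inside
    -- BC gives no central triangle.
    trapezoid-count : ∀ n i j p q → 0 < i → 0 < p + q → i + p ≡ B → C + q ≡ j → j ≤ L → j ≤ n + i →
      count n i j ≡ trapezoid a g p q
    trapezoid-count n i j zero zero 0<i () i≡ j≡ j≤L fuel
    trapezoid-count n i j zero (suc q) 0<i _ i≡ j≡ j≤L fuel =
      Strip.strip-count strip-C n i j a q (≤-reflexive (sym i≡B)) (trans (cong (_+ suc a) i≡B) B+1+a≡C) j≡ j≤L fuel
      where
      i≡B : i ≡ B
      i≡B = trans (sym (+-identityʳ i)) i≡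
    trapezoid-count n i j (suc p) zero 0<i _ i≡ j≡ j≤L fuel =
      Strip.strip-count strip-B n i j p a z≤n i≡ (trans B+1+a≡C C≡j) (≤-reflexive (sym C≡j)) fuel
      where
      C≡j : C ≡ j
      C≡j = trans (sym (+-identityʳ C)) j≡
    trapezoid-count zero i j (suc p) (suc q) 0<i _ i≡ refl j≤L fuel =
      ⊥-elim (<⇒≱ (<-trans (subst (i <_) i≡ (m<m+n i z<s)) (<-trans B<C (m<m+n C z<s))) fuel)
    trapezoid-count (suc n) i j (suc p) (suc q) 0<i _ i≡ j≡ j≤L fuel =
      trans split (cong₂ _+_
        (trans left-part (trapezoid-count n (suc i) j p (suc q) z<s (<-≤-trans z<s (m≤n+m (suc q) p)) 1+i+p≡B j≡ j≤L
          (fuel-right n fuel ≤-refl)))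
        (cong₂ _+_ (middle g refl)
          (trans (right-part 0<i) (trapezoid-count n i (C + q) (suc p) q 0<i z<s i≡ refl
             (≤-trans (<⇒≤ before) j≤L) (fuel-left {n = n} fuel before)))))
      where
      open Split n i j p q i≡ j≡ j≤L fuel
      before : C + q < j
      before = ≤-reflexive 1+C+q≡j
      middle : ∀ g′ → g ≡ g′ → sumFrom (suc B) a f ≡ (if g′ then fan p q 0 a else 0)
      middle true  refl = middle-fan (λ _ → inj₂ tt)
      middle false g≡   = middle-zero 0<i g≡

    -- For b = 0 the polygon 0..L is itself a strip around B.
    total-count-zero : b ≡ 0 → count (suc L) 0 L ≡ paths c a
    total-count-zero refl = Strip.strip-count strip-B (suc L) 0 L c a z≤n (+-comm 1 c) (trans B+1+a≡C C≡L)
      (≤-reflexive (sym C≡L)) (≤-trans (n≤1+n L) (m≤m+n (suc L) 0))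
      where
      C≡L : C ≡ L
      C≡L = trans (sym (+-identityʳ C)) C+b≡L

    -- At the base, the apex 1 leaves a trapezoid; an apex inside BC yields a diagonal from A and
    -- two strips, for either value of `g`; an apex on CA would put a side of the triangle along CA.
    total-count-suc : ∀ b′ → b ≡ suc b′ →
      count (suc L) 0 L ≡ trapezoid a g c b + fan c b′ 0 a
    total-count-suc b′ refl = trans split (cong₂ _+_
      (trans left-part (trapezoid-count L 1 L c (suc b′) ≤-refl (<-≤-trans z<s (m≤n+m (suc b′) c))
         (+-comm 1 c) C+b≡L ≤-refl (m≤m+n L 1)))
      (trans (cong₂ _+_ (middle-fan (λ k → inj₁ λ { ((() , _) , _) })) (right-zero refl)) (+-identityʳ _)))
      where
      open Split L 0 L c b′ (+-comm 1 c) C+b≡L ≤-refl (≤-trans (n≤1+n L) (m≤m+n (suc L) 0))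

-- Counting by duplicate-free lists.

-- Injectivity is relative to `P` because `matrix` is shown injective only on trees that triangulate
-- the polygon.
unique-map⁺ : ∀ {X Y : Set} {P : X → Set} {f : X → Y} → (∀ {x y} → P x → P y → f x ≡ f y → x ≡ y) →
  ∀ {xs} → All P xs → Unique xs → Unique (map f xs)
unique-map⁺ inj [] [] = []
unique-map⁺ inj (px ∷ pxs) (x∉ ∷ u) =
  All.map⁺ (All.zipWith (λ { (py , x≢y) eq → x≢y (inj px py eq) }) (pxs , x∉)) ∷ unique-map⁺ inj pxs u

numberIs-⇔ : ∀ {X : Set} {P Q : X → Set} {n} → (∀ x → P x ⇔ Q x) → NumberIs P n → NumberIs Q n
numberIs-⇔ P⇔Q (xs , u , mem , len) = xs , u , mem′ , len
  where
  mem′ : ∀ x → (x ∈ xs) ⇔ _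
  mem′ x = mk⇔ (to (P⇔Q x) ∘ to (mem x)) (from (mem x) ∘ from (P⇔Q x))
    where open Equivalence

-- Two duplicate-free lists with the same members are permutations of each other, so the list for
-- `P` is as long as the two lists for its parts together.
numberIs-difference : ∀ {X : Set} {P R : X → Set} {n m} → (∀ x → Dec (R x)) →
  NumberIs P n → NumberIs (λ x → P x × ¬ R x) m → Σ ℕ λ t → NumberIs (λ x → P x × R x) t × n ≡ m + t
numberIs-difference {P = P} {R} R? (xs , u , mem , refl) (ys , v , mem′ , refl) =
  length zs , (zs , Unique.filter⁺ R? u , mem″ , refl)
  , trans (↭-length (∼bag⇒↭ (unique∧set⇒bag u (Unique.++⁺ v (Unique.filter⁺ R? u) disjoint)
      (λ {x} → mk⇔ (split x) (merge x))))) (length-++ ys)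
  where
  open Equivalence
  zs = filter R? xs
  mem″ : ∀ x → (x ∈ zs) ⇔ (P x × R x)
  mem″ x = mk⇔ (λ x∈ → to (mem x) (proj₁ (∈-filter⁻ R? {xs = xs} x∈)) , proj₂ (∈-filter⁻ R? {xs = xs} x∈))
               (λ (p , r) → ∈-filter⁺ R? (from (mem x) p) r)
  disjoint : ∀ {x} → ¬ (x ∈ ys × x ∈ zs)
  disjoint {x} (y∈ , z∈) = proj₂ (to (mem′ x) y∈) (proj₂ (to (mem″ x) z∈))
  split : ∀ x → x ∈ xs → x ∈ ys ++ zs
  split x x∈ with R? x
  ... | yes r = ∈-++⁺ʳ ys (from (mem″ x) (to (mem x) x∈ , r))
  ... | no ¬r = ∈-++⁺ˡ (from (mem′ x) (to (mem x) x∈ , ¬r))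
  merge : ∀ x → x ∈ ys ++ zs → x ∈ xs
  merge x x∈ with ∈-++⁻ ys x∈
  ... | inj₁ y∈ = from (mem x) (proj₁ (to (mem′ x) y∈))
  ... | inj₂ z∈ = from (mem x) (proj₁ (to (mem″ x) z∈))

does-true : ∀ {P : Set} (P? : Dec P) → does P? ≡ true → P
does-true (yes p) _ = p

true-ext : ∀ {x y : Bool} → (x ≡ true → y ≡ true) → (y ≡ true → x ≡ true) → x ≡ y
true-ext {true}  {true}  _ _ = refl
true-ext {true}  {false} f _ = sym (f refl)
true-ext {false} {true}  _ g = g refl
true-ext {false} {false} _ _ = refl

lookup-ext : ∀ {X : Set} {n} {xs ys : Vec X n} → (∀ i → lookup xs i ≡ lookup ys i) → xs ≡ ys
lookup-ext {xs = xs} {ys} eq = trans (sym (tabulate∘lookup xs)) (trans (tabulate-cong eq) (tabulate∘lookup ys))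

-- The bijection between trees and diagonal matrices.

module Matrices (a b c : ℕ) where
  open Triangle a b c

  n : ℕ
  n = N a b c

  n≡1+L : n ≡ suc L
  n≡1+L = +-suc (a + b + c) 2

  toℕ≤L : ∀ (i : Fin n) → toℕ i ≤ L
  toℕ≤L i = s≤s⁻¹ (subst (toℕ i <_) n≡1+L (toℕ<n i))

  point : ∀ {p} → p ≤ L → Σ (Fin n) λ i → toℕ i ≡ p
  point {p} p≤L = fromℕ< p<n , toℕ-fromℕ< p<n
    where
    p<n : p < n
    p<n = subst (p <_) (sym n≡1+L) (s≤s p≤L)

  has? : ∀ M i j → Dec (Has a b c M i j)
  has? M i j = lookup (lookup M i) j Bool.≟ true

  hasCentral? : ∀ M → Dec (HasCentralTriangle a b c M)
  hasCentral? M = any? λ i → any? λ j → any? λ k →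
    ((c + 2 ≤? toℕ i) ×-dec (toℕ i ≤? c + a + 1)) ×-dec (c + a + 3 ≤? toℕ j)
    ×-dec ((1 ≤? toℕ k) ×-dec (toℕ k ≤? c)) ×-dec edge? i j ×-dec edge? j k ×-dec edge? i k
    where
    boundary? : ∀ i j → Dec (Boundary a b c i j)
    boundary? i j = (j ≟ suc i) ⊎-dec ((i ≟ suc j) ⊎-dec
      (((i ≟ 0) ×-dec (suc j ≟ n)) ⊎-dec ((j ≟ 0) ×-dec (suc i ≟ n))))
    edge? : ∀ i j → Dec (Edge a b c M i j)
    edge? i j = has? M i j ⊎-dec (has? M j i ⊎-dec boundary? (toℕ i) (toℕ j))

  edge-sym : ∀ {M i j} → Edge a b c M i j → Edge a b c M j i
  edge-sym (inj₁ h)                        = inj₂ (inj₁ h)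
  edge-sym (inj₂ (inj₁ h))                 = inj₁ h
  edge-sym (inj₂ (inj₂ (inj₁ e)))          = inj₂ (inj₂ (inj₂ (inj₁ e)))
  edge-sym (inj₂ (inj₂ (inj₂ (inj₁ e))))        = inj₂ (inj₂ (inj₁ e))
  edge-sym (inj₂ (inj₂ (inj₂ (inj₂ (inj₁ e))))) = inj₂ (inj₂ (inj₂ (inj₂ (inj₂ e))))
  edge-sym (inj₂ (inj₂ (inj₂ (inj₂ (inj₂ e))))) = inj₂ (inj₂ (inj₂ (inj₂ (inj₁ e))))

  -- The base and the boundary edges lie on sides of ABC and must not be entries of the matrix;
  -- `Edge` adds them back.
  Drawn : Tree → ℕ → ℕ → Set
  Drawn t p q = Edges t 0 L p q × A p q

  drawn? : ∀ t p q → Dec (Drawn t p q)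
  drawn? t p q = edges? t 0 L p q ×-dec A? p q

  matrix : Tree → DiagSet a b c
  matrix t = tabulate λ i → tabulate λ j → does (drawn? t (toℕ i) (toℕ j))

  lookup-matrix : ∀ t i j → lookup (lookup (matrix t) i) j ≡ does (drawn? t (toℕ i) (toℕ j))
  lookup-matrix t i j = trans
    (cong (λ v → lookup v j) (lookup∘tabulate (λ i → tabulate λ j → does (drawn? t (toℕ i) (toℕ j))) i))
    (lookup∘tabulate (λ j → does (drawn? t (toℕ i) (toℕ j))) j)

  has⇒drawn : ∀ t {i j} → Has a b c (matrix t) i j → Drawn t (toℕ i) (toℕ j)
  has⇒drawn t {i} {j} h = does-true (drawn? t (toℕ i) (toℕ j)) (trans (sym (lookup-matrix t i j)) h)

  drawn⇒has : ∀ t {i j} → Drawn t (toℕ i) (toℕ j) → Has a b c (matrix t) i j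
  drawn⇒has t {i} {j} d = trans (lookup-matrix t i j) (dec-true (drawn? t (toℕ i) (toℕ j)) d)

  module _ (g : Bool) where
    open Counting g

    Admissible : DiagSet a b c → Set
    Admissible M = IsTriangulation a b c M × (¬ HasCentralTriangle a b c M ⊎ T g)

    matrix-triangulation : ∀ {t} → Triangulates 0 L t → IsTriangulation a b c (matrix t)
    matrix-triangulation {t} w =
        (λ i j h → edge-< w (proj₁ (has⇒drawn t h)) , proj₂ (has⇒drawn t h))
      , (λ i j k l h h′ → noncrossing w (proj₁ (has⇒drawn t h)) (proj₁ (has⇒drawn t h′)))
      , crossed
      where
      crossed : ∀ i j → toℕ i < toℕ j → A (toℕ i) (toℕ j) → ¬ Has a b c (matrix t) i j →
        Σ (Fin n) λ k → Σ (Fin n) λ l → Has a b c (matrix t) k l × Cross a b c (toℕ i) (toℕ j) (toℕ k) (toℕ l)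
      crossed i j i<j allowed ¬h with maximal w z≤n i<j (toℕ≤L j)
      ... | inj₁ e = ⊥-elim (¬h (drawn⇒has t (e , allowed)))
      ... | inj₂ (_ , _ , e , a′ , cross) with point (≤-trans (<⇒≤ (edge-< w e)) (edge-≤ w e)) | point (edge-≤ w e)
      ...   | k , refl | l , refl = k , l , drawn⇒has t (e , a′) , cross

    matrix-edge : ∀ {t} → Triangulates 0 L t → ∀ {i j} → toℕ i < toℕ j →
      Edge a b c (matrix t) i j → Edges t 0 L (toℕ i) (toℕ j)
    matrix-edge {t} w i<j (inj₁ h) = proj₁ (has⇒drawn t h)
    matrix-edge {t} w i<j (inj₂ (inj₁ h)) = ⊥-elim (<-asym i<j (edge-< w (proj₁ (has⇒drawn t h))))
    matrix-edge {t} w {i} {j} i<j (inj₂ (inj₂ (inj₁ eq))) = subst (Edges t 0 L (toℕ i)) (sym eq)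
      (boundary-edge w z≤n (<-≤-trans i<j (toℕ≤L j)))
    matrix-edge w i<j (inj₂ (inj₂ (inj₂ (inj₁ eq)))) = ⊥-elim (<-asym i<j (≤-reflexive (sym eq)))
    -- The boundary edge that closes the cycle is the base of the tree.
    matrix-edge {t} w i<j (inj₂ (inj₂ (inj₂ (inj₂ (inj₁ (i≡0 , 1+j≡n)))))) =
      subst₂ (Edges t 0 L) (sym i≡0) (sym (suc-injective (trans 1+j≡n n≡1+L))) base
    matrix-edge w {i} i<j (inj₂ (inj₂ (inj₂ (inj₂ (inj₂ (j≡0 , _)))))) = ⊥-elim (n≮0 (subst (toℕ i <_) j≡0 i<j))

    AB<BC : ∀ {x y} → InAB a b c x → InBC a b c y → x < y
    AB<BC (_ , x≤c) (c+2≤y , _) = ≤-<-trans x≤c (<-≤-trans (m<m+n c z<s) c+2≤y)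

    BC<CA : ∀ {x y} → InBC a b c x → InCA a b c y → x < y
    BC<CA (_ , x≤) y≥ = ≤-<-trans x≤ (<-≤-trans (+-monoʳ-< (c + a) (s≤s (s≤s z≤n))) y≥)

    -- The insides of AB, BC and CA come in this order in the numbering, so a central triangle has k
    -- < i < j and `triangle-good` locates it at an apex of the tree.
    matrix-central : ∀ {t} → Triangulates 0 L t → ¬ HasCentralTriangle a b c (matrix t) ⊎ T g
    matrix-central {t} w = decide (T? g)
      where
      impossible : ¬ T g → ¬ HasCentralTriangle a b c (matrix t)
      impossible ¬Tg (i , j , k , i∈ , j∈ , k∈ , eij , ejk , eik)
        with triangle-good w
          (matrix-edge w (AB<BC k∈ i∈) (edge-sym {matrix t} {i} {k} eik))
          (matrix-edge w (BC<CA i∈ j∈) eij)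
          (matrix-edge w (<-trans (AB<BC k∈ i∈) (BC<CA i∈ j∈)) (edge-sym {matrix t} {j} {k} ejk))
      ... | inj₁ ¬central = ¬central (k∈ , i∈ , j∈)
      ... | inj₂ Tg = ¬Tg Tg
      decide : Dec (T g) → ¬ HasCentralTriangle a b c (matrix t) ⊎ T g
      decide (yes Tg) = inj₂ Tg
      decide (no ¬Tg) = inj₁ (impossible ¬Tg)

    module _ {M : DiagSet a b c} (M-triang : IsTriangulation a b c M) where

      HasAt : ℕ → ℕ → Set
      HasAt p q = Σ (Fin n) λ i → Σ (Fin n) λ j → toℕ i ≡ p × toℕ j ≡ q × Has a b c M i j

      hasAt? : ∀ p q → Dec (HasAt p q)
      hasAt? p q = any? λ i → any? λ j → (toℕ i ≟ p) ×-dec ((toℕ j ≟ q) ×-dec has? M i j)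

      has⇒hasAt : ∀ {i j} → Has a b c M i j → HasAt (toℕ i) (toℕ j)
      has⇒hasAt h = _ , _ , refl , refl , h

      hasAt⇒has : ∀ {i j} → HasAt (toℕ i) (toℕ j) → Has a b c M i j
      hasAt⇒has (_ , _ , i≡ , j≡ , h) with toℕ-injective i≡ | toℕ-injective j≡
      ... | refl | refl = h

      hasAt-maximal : ∀ {p q} → p < q → q ≤ L → A p q → ¬ HasAt p q → ∃₂ λ k l → HasAt k l × Crossing p q k l
      hasAt-maximal p<q q≤L allowed ¬h with point (≤-trans (<⇒≤ p<q) q≤L) | point q≤L
      ... | i , refl | j , refl with proj₂ (proj₂ M-triang) i j p<q allowed (¬h ∘ has⇒hasAt)
      ...   | k , l , h , cross = _ , _ , has⇒hasAt h , cross

      hasAt-allowed : ∀ {p q} → HasAt p q → p < q × q ≤ L × A p q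
      hasAt-allowed (i , j , refl , refl , h) = proj₁ (proj₁ M-triang i j h) , toℕ≤L j , proj₂ (proj₁ M-triang i j h)

      hasAt-noncrossing : ∀ {p q k l} → HasAt p q → HasAt k l → ¬ Crossing p q k l
      hasAt-noncrossing (i , j , refl , refl , h) (k , l , refl , refl , h′) =
        proj₁ (proj₂ M-triang) i j k l h h′

      open Complete L degenerate HasAt hasAt? hasAt-allowed hasAt-noncrossing hasAt-maximal

      side⇒edge : ∀ {i j} → Side (toℕ i) (toℕ j) → Edge a b c M i j
      side⇒edge (inj₁ adj) = inj₂ (inj₂ (inj₁ adj))
      side⇒edge (inj₂ (inj₁ (i≡0 , j≡L))) =
        inj₂ (inj₂ (inj₂ (inj₂ (inj₁ (i≡0 , trans (cong suc j≡L) (sym n≡1+L))))))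
      side⇒edge (inj₂ (inj₂ h)) = inj₁ (hasAt⇒has h)

      triangulation-tree : ¬ HasCentralTriangle a b c M ⊎ T g → Σ Tree λ t → Triangulates 0 L t × M ≡ matrix t
      triangulation-tree central with complete (good central) (<-≤-trans (≤-<-trans z≤n B<C) C≤L)
        where
        good : ¬ HasCentralTriangle a b c M ⊎ T g → ∀ {x y z} → x < y → y < z → z ≤ L →
          Side x y → Side y z → Side x z → Good x y z
        good (inj₂ Tg) _ _ _ _ _ _ = inj₂ Tg
        good (inj₁ ¬central) x<y y<z z≤L sxy syz sxz
          with point (<⇒≤ (<-trans x<y (<-≤-trans y<z z≤L))) | point (<⇒≤ (<-≤-trans y<z z≤L)) | point z≤L
        ... | k , refl | i , refl | j , refl = inj₁ λ { (k∈ , i∈ , j∈) →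
          ¬central (i , j , k , i∈ , j∈ , k∈ , side⇒edge syz , edge-sym {M} {k} {j} (side⇒edge sxz)
                   , edge-sym {M} {k} {i} (side⇒edge sxy)) }
      ... | t , w , to , from = t , w , lookup-ext λ i → lookup-ext λ j → true-ext
        (λ h → drawn⇒has t (to (has⇒hasAt h)))
        (λ h → hasAt⇒has (from (proj₁ (has⇒drawn t h)) (proj₂ (has⇒drawn t h))))

    matrix-injective : ∀ {t t′} → Triangulates 0 L t → Triangulates 0 L t′ → matrix t ≡ matrix t′ → t ≡ t′
    matrix-injective {t} {t′} w w′ eq = allowed-edges-injective w w′ sub
      where
      sub : ∀ {p q} → A p q → Edges t 0 L p q → Edges t′ 0 L p q
      sub allowed e with point (≤-trans (<⇒≤ (edge-< w e)) (edge-≤ w e)) | point (edge-≤ w e)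
      ... | i , refl | j , refl =
        proj₁ (has⇒drawn t′ (subst (λ M → Has a b c M i j) eq (drawn⇒has t (e , allowed))))

    number-admissible : NumberIs Admissible (count (suc L) 0 L)
    number-admissible = map matrix ts
      , unique-map⁺ matrix-injective (All.tabulate (trees-sound (suc L) 0 L)) (trees-unique (suc L) 0 L)
      , (λ M → mk⇔ to from)
      , length-map matrix ts
      where
      ts = trees (suc L) 0 L
      to : ∀ {M} → M ∈ map matrix ts → Admissible M
      to M∈ with ∈-map⁻ matrix M∈
      ... | t , t∈ , refl = matrix-triangulation (trees-sound (suc L) 0 L t∈) , matrix-central (trees-sound (suc L) 0 L t∈)
      from : ∀ {M} → Admissible M → M ∈ map matrix ts
      from {M} (M-triang , central) with triangulation-tree {M} M-triang central
      ... | t , w , refl = ∈-map⁺ matrix (trees-complete (suc L) (≤-trans (n≤1+n L) (m≤m+n (suc L) 0)) w)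

-- Assembling the three formulas.

-- For b > 0 the diagonals from A account for the binomial of a, and the trapezoid left by the apex
-- 1 for the other two. For b = 0 the single strip gives the binomials of a and c.
count-closed : ∀ a b c g m → suc m ≡ a + b + c →
  let open Triangle a b c in
  Counting.count g (suc L) 0 L ≡ binomPred m a + binomPred m b + binomPred m c + (if g then central a c b else 0)
count-closed a zero c g m s≡ = begin
  Counting.count g (suc L) 0 L
    ≡⟨ Counting.total-count-zero g refl ⟩
  paths c a
    ≡⟨ paths-binomPred m c a (trans (+-comm c a) (trans (cong (_+ c) (sym (+-identityʳ a))) (sym s≡))) ⟩
  binomPred m a + binomPred m c
    ≡⟨ cong (_+ binomPred m c) (sym (+-identityʳ (binomPred m a))) ⟩
  binomPred m a + 0 + binomPred m c
    ≡⟨ sym (+-identityʳ _) ⟩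
  binomPred m a + 0 + binomPred m c + 0
    ≡⟨ cong (binomPred m a + 0 + binomPred m c +_)
         (sym (trans (cong (λ x → if g then x else 0) (central-zeroʳ a c)) (if-zero g))) ⟩
  binomPred m a + 0 + binomPred m c + (if g then central a c 0 else 0) ∎
  where
  open ≡-Reasoning
  open Triangle a 0 c
count-closed a (suc b) c g m s≡ = begin
  Counting.count g (suc L) 0 L
    ≡⟨ Counting.total-count-suc g b refl ⟩
  trapezoid a g c (suc b) + fan c b 0 a
    ≡⟨ cong₂ _+_ (trapezoid-closed m a g c (suc b) (<-≤-trans z<s (m≤n+m (suc b) c)) c+b+a≡)
         (trans (fan≡binomPred c b a) (cong (λ k → binomPred k a) (suc-injective (trans (cong (_+ a) (sym (+-suc c b))) c+b+a≡)))) ⟩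
  binomPred m c + binomPred m (suc b) + X + binomPred m a
    ≡⟨ shape (binomPred m c) (binomPred m (suc b)) X (binomPred m a) ⟩
  binomPred m a + binomPred m (suc b) + binomPred m c + X ∎
  where
  open ≡-Reasoning
  open Triangle a (suc b) c
  X = if g then central a c (suc b) else 0
  swap-sum : ∀ x y z → x + y + z ≡ z + y + x
  swap-sum = solve-∀
  c+b+a≡ : c + suc b + a ≡ suc m
  c+b+a≡ = trans (swap-sum c (suc b) a) (sym s≡)
  shape : ∀ x y z w → x + y + z + w ≡ w + y + x + z
  shape = solve-∀

theorem5p2 : (a b c : ℕ) → 0 < a + b + c →
    let s = a + b + c in
    NumberIs (IsDTriangulation a b c)
    (binomPred (s ∸ 1) a + binomPred (s ∸ 1) b + binomPred (s ∸ 1) c)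
    × (Σ ℕ λ t → NumberIs (IsTTriangulation a b c) t
    × t + bsum (s ∸ 1) a + bsum (s ∸ 1) b + bsum (s ∸ 1) c ≡ 2 ^ (s ∸ 1))
    × (Σ ℕ λ n → NumberIs (IsTriangulation a b c) n
    × n + bsum (s ∸ 1) (a ∸ 1) + bsum (s ∸ 1) (b ∸ 1) + bsum (s ∸ 1) (c ∸ 1)
    ≡ 2 ^ (s ∸ 1))
theorem5p2 a b c 0<s = numberD , (t , numberT , t-closed) , (D + τ , numberAll , all-closed)
  where
  open ≡-Reasoning
  open Matrices a b c
  m τ D : ℕ
  m = a + b + c ∸ 1
  τ = central a c b
  D = binomPred m a + binomPred m b + binomPred m c

  1+m≡s : suc m ≡ a + b + c
  1+m≡s = m+[n∸m]≡n 0<s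

  numberD : NumberIs (IsDTriangulation a b c) D
  numberD = subst (NumberIs (IsDTriangulation a b c)) (trans (count-closed a b c false m 1+m≡s) (+-identityʳ D))
    (numberIs-⇔ (λ M → mk⇔ (λ { (tri , inj₁ ¬central) → tri , ¬central ; (_ , inj₂ ()) })
                            (λ (tri , ¬central) → tri , inj₁ ¬central))
      (number-admissible false))

  numberAll : NumberIs (IsTriangulation a b c) (D + τ)
  numberAll = subst (NumberIs (IsTriangulation a b c)) (count-closed a b c true m 1+m≡s)
    (numberIs-⇔ (λ M → mk⇔ proj₁ (λ tri → tri , inj₂ tt)) (number-admissible true))

  difference : Σ ℕ λ t → NumberIs (IsTTriangulation a b c) t × D + τ ≡ D + t
  difference = numberIs-difference hasCentral? numberAll numberD

  t : ℕ
  t = proj₁ difference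

  numberT : NumberIs (IsTTriangulation a b c) t
  numberT = proj₁ (proj₂ difference)

  τ-closed : τ + bsum m a + bsum m b + bsum m c ≡ 2 ^ m
  τ-closed = trans (shape τ (bsum m a) (bsum m b) (bsum m c))
    (central-closed m a c b (trans (swap-sum c b a) (sym 1+m≡s)))
    where
    shape : ∀ x y z w → x + y + z + w ≡ x + y + w + z
    shape = solve-∀
    swap-sum : ∀ x y z → x + y + z ≡ z + y + x
    swap-sum = solve-∀

  t-closed : t + bsum m a + bsum m b + bsum m c ≡ 2 ^ m
  t-closed = subst (λ x → x + bsum m a + bsum m b + bsum m c ≡ 2 ^ m)
    (+-cancelˡ-≡ D τ t (proj₂ (proj₂ difference))) τ-closed

  -- Each binomial in `D` is the last term missing from one of the sums; absorbing all three reduces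
  -- the claim to `τ-closed`.
  all-closed : D + τ + bsum m (a ∸ 1) + bsum m (b ∸ 1) + bsum m (c ∸ 1) ≡ 2 ^ m
  all-closed = begin
    D + τ + bsum m (a ∸ 1) + bsum m (b ∸ 1) + bsum m (c ∸ 1)
      ≡⟨ shape (binomPred m a) (binomPred m b) (binomPred m c) τ (bsum m (a ∸ 1)) (bsum m (b ∸ 1)) (bsum m (c ∸ 1)) ⟩
    τ + (bsum m (a ∸ 1) + binomPred m a) + (bsum m (b ∸ 1) + binomPred m b) + (bsum m (c ∸ 1) + binomPred m c)
      ≡⟨ cong₂ _+_ (cong₂ _+_ (cong (τ +_) (bsum-pred m a)) (bsum-pred m b)) (bsum-pred m c) ⟩
    τ + bsum m a + bsum m b + bsum m c
      ≡⟨ τ-closed ⟩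
    2 ^ m ∎
    where
    shape : ∀ α β γ τ x y z → α + β + γ + τ + x + y + z ≡ τ + (x + α) + (y + β) + (z + γ)
    shape = solve-∀
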